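{- There is an absolute constant $c>0$ such that for all integers $n\ge 2$ and $k\ge 1$: if there is a $\mathrm{MAJ}_k\circ\mathrm{MAJ}_k$ circuit on the variables $x_1,\dots,x_n$ that computes $\mathrm{MAJ}_n$ correctly on all inputs in $\{0,1\}^n$, then $$k\ \ge\ c\, n^{13/19}\,(\log n)^{ -2/19}.$$
   Context: $\mathrm{MAJ}_n(x_1,\dots,x_n)=1$ if $\sum_{i=1}^n x_i\ge n/2$, and $0$ otherwise. For a positive integer $k$, a $\mathrm{MAJ}_k\circ\mathrm{MAJ}_k$ circuit on $x_1,\dots,x_n$ is a depth two formula with a single top gate whose inputs are bottom-level gates, the inputs of each bottom-level gate being variables among $x_1,\dots,x_n$. Every gate (top and bottom) is a threshold gate: with inputs $z_1,\dots,z_r$ it outputs $1$ if $\sum_i c_i z_i\ge t$ and $0$ otherwise, where the weights $c_i$ are positive integers with $\sum_i c_i\le k$ and $t$ is an arbitrary integer threshold (weights and thresholds may differ from gate to gate). A weight $c_i$ can equivalently be seen as repeating the input $z_i$ $c_i$ times. -}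

module Defs where

open import Data.Bool.Base using (Bool; if_then_else_)
open import Data.Fin.Base using (Fin)
open import Data.Integer.Base using (ℤ; +_)
import Data.Integer.Properties as ℤ
open import Data.Nat.Base using (ℕ; NonZero; _*_; _^_; _≤_)
open import Data.Nat.Properties using (_≤?_; +-*-semiring)
open import Data.Rational.Base as ℚ using (ℚ; _/_)
open import Data.Vec.Functional using (Vector)
open import Relation.Binary.PropositionalEquality.Core using (_≡_)
open import Relation.Nullary.Decidable using (does)

open import Algebra.Properties.Semiring.Sum +-*-semiring public
  using (sum; sum-syntax)
open import Algebra.Definitions.RawSemiring ℚ.+-*-rawSemiring public
  using () renaming (_^_ to _^ℚ_)

bit : Bool → ℕ
bit b = if b then 1 else 0

-- n ≤ 2 * s is s ≥ n/2 with the denominator cleared.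
MAJ : ∀ {n} → Vector Bool n → Bool
MAJ {n} x = does (n ≤? 2 * (∑[ i < n ] bit (x i)))

-- A threshold gate of total weight at most k whose input wires are labelled
-- by elements of A.
record Gate (k : ℕ) (A : Set) : Set where
  field
    fanIn     : ℕ
    input     : Vector A fanIn
    weight    : Vector ℕ fanIn
    positive  : ∀ i → 1 ≤ weight i
    bounded   : sum weight ≤ k
    threshold : ℤ

evalGate : ∀ {k A} → Gate k A → (A → Bool) → Bool
evalGate g v = does (threshold ℤ.≤? + (∑[ i < fanIn ] (weight i * bit (v (input i)))))
  where open Gate g

MAJ∘MAJ : (k n : ℕ) → Set
MAJ∘MAJ k n = Gate k (Gate k (Fin n))

evalCircuit : ∀ {k n} → MAJ∘MAJ k n → Vector Bool n → Bool
evalCircuit C x = evalGate C (λ g → evalGate g x)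

Computes-MAJ : ∀ {k n} → MAJ∘MAJ k n → Set
Computes-MAJ {n = n} C = ∀ (x : Vector Bool n) → evalCircuit C x ≡ MAJ x

ℕ→ℚ : ℕ → ℚ
ℕ→ℚ m = + m / 1

infix 4 log₂_≤_÷_

-- log₂ n ≤ p / q, for n ≥ 1 and q ≥ 1.
log₂_≤_÷_ : ℕ → ℕ → ℕ → Set
log₂ n ≤ p ÷ q = n ^ q ≤ 2 ^ p

-- The real inequality  k ≥ c · n^(13/19) · (log₂ n)^(-2/19)  for n ≥ 2 and
-- c > 0.  Taking 19th powers, it says  c¹⁹ · n¹³ ≤ k¹⁹ · (log₂ n)²; and since
-- log₂ n is the infimum of the rationals p / q above it, this holds exactly
-- when it holds with every such p / q in place of log₂ n.  Changing the base
-- of the logarithm only rescales c.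
LowerBound : (c : ℚ) (n k : ℕ) → Set
LowerBound c n k =
  ∀ (p q : ℕ) .{{_ : NonZero q}} → log₂ n ≤ p ÷ q →
  (c ^ℚ 19) ℚ.* ℕ→ℚ (n ^ 13) ℚ.≤ ℕ→ℚ (k ^ 19) ℚ.* ((+ p / q) ^ℚ 2)

{-# OPTIONS --safe #-}

-- Write A_i = 1^i 0^(n − i), let T = ⌈n/2⌉, and let p > k be a prime with
-- i + 1 + p = T. Put A_(i+1) on the first i + 1 variables and a free
-- y ∈ {0,1}^(p + k) on the next ones. If y has exactly k zeros, switching
-- variable i off turns the majority off, so it turns off a bottom gate j, which
-- means that its weighted sum lies in [t_j, t_j + w_j), w_j being the weight of
-- variable i in gate j. Hence the product F(y) of the ∑ w_j affine factors
-- (weighted sum − t_j − s), s < w_j, vanishes on that slice. When ∑ w_j ≤ k the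
-- degree of F is so small that the sum of F over the slice is
-- C(p + k, k) · F(0) modulo p, so p divides F(0); all factors of F(0) have
-- absolute value at most k < p, so one of them is 0, and gate j switches on
-- between A_i and A_(i+1).
--
-- Each of the at most k bottom gates switches on at most once along the chain
-- and has total weight at most k, so there are at most 2k primes in (k, T).
-- Chebyshev's bound 2^N ≤ (N + 1)^π(N + 1), from the lower bound 2^N on the common
-- multiples of 1, …, N + 1, then gives n = O(k log k), more than is claimed.
module Submission where

open import Algebra.Bundles using (CommutativeRing)
import Data.Bool.Properties as Bool
open import Data.Bool.Base using (Bool; true; false; _∧_)
open import Data.Fin.Base using (Fin; zero; suc; toℕ; fromℕ<)
open import Data.Fin.Properties using (toℕ<n; toℕ-fromℕ<; ¬∀⟶∃¬)
open import Data.Integer.Base as ℤ using (ℤ; +_; -[1+_]; 0ℤ; 1ℤ)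
open import Data.Integer.Divisibility.Signed
import Data.Integer.Properties as ℤ
import Data.Integer.Tactic.RingSolver as ℤ-Solver
open import Data.Nat.Base
open import Data.Nat.Combinatorics
  using (nCk≡n!/k![n-k]!; k![n∸k]!∣n!; nCk+nC[k+1]≡[n+1]C[k+1])
  renaming (_C_ to _choose_)
import Data.Nat.Divisibility as ℕ
open import Data.Nat.DivMod using (m/n*n≤m; m/n*n≡m; m≡m%n+[m/n]*n; m%n<n)
open import Data.Nat.Induction using (<-rec)
open import Data.Nat.Primality
open import Data.Nat.Properties
open import Data.Nat.Tactic.RingSolver using (solve-∀)
open import Data.Product.Base using (∃-syntax; _×_; _,_; proj₁; proj₂)
open import Data.Rational.Base as ℚ using (ℚ; 0ℚ; 1ℚ)
import Data.Rational.Properties as ℚ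
import Data.Rational.Unnormalised.Base as ℚᵘ
import Data.Rational.Unnormalised.Properties as ℚᵘ
open import Data.Sum.Base using (_⊎_; inj₁; inj₂; [_,_]′)
open import Data.Unit.Base using (⊤; tt)
open import Data.Vec.Base using (Vec; []; _∷_; replicate; _++_)
open import Data.Vec.Functional using (Vector)
open import Defs
open import Function.Base using (_∘_; id; case_of_)
open import Relation.Binary.PropositionalEquality
open import Relation.Nullary using (Dec; yes; no; does; contradiction)
open import Relation.Nullary.Decidable using (dec-true; dec-false)
open import Algebra.Properties.CommutativeSemigroup *-commutativeSemigroup using (x∙yz≈y∙xz)
open import Algebra.Properties.CommutativeSemiring.Exp (CommutativeRing.commutativeSemiring ℚ.+-*-commutativeRing)
  using () renaming (^-distrib-* to ^ℚ-distrib-*)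
open import Algebra.Properties.Monoid.Sum ℤ.*-1-monoid using () renaming (sum to ∏)
open import Algebra.Properties.Semiring.Sum +-*-semiring
  using (sum-cong-≗; ∑-distrib-+; ∑-comm; *-distribˡ-sum)

-- Common multiples of 1, …, N and the number of primes

-- The quotient (a + k)! / a!, which lets Leibniz entries be described without division.
rising : ℕ → ℕ → ℕ
rising a zero    = 1
rising a (suc k) = suc a * rising (suc a) k

rising-snoc : ∀ a k → rising a (suc k) ≡ rising a k * suc (a + k)
rising-snoc a zero    rewrite +-identityʳ a = *-comm (suc a) 1
rising-snoc a (suc k) = begin
  suc a * rising (suc a) (suc k)                ≡⟨ cong (suc a *_) (rising-snoc (suc a) k) ⟩
  suc a * (rising (suc a) k * suc (suc a + k))  ≡⟨ *-assoc (suc a) (rising (suc a) k) _ ⟨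
  rising a (suc k) * suc (suc a + k)            ≡⟨ cong (λ m → rising a (suc k) * suc m) (+-suc a k) ⟨
  rising a (suc k) * suc (a + suc k)            ∎
  where open ≡-Reasoning

rising>0 : ∀ a k → 0 < rising a k
rising>0 a zero    = z<s
rising>0 a (suc k) = *-mono-< {0} {suc a} z<s (rising>0 (suc a) k)

-- c is the entry L · a! b! / (a + b + 1)! of L times the Leibniz harmonic
-- triangle.
LeibnizEntry : (L a b c : ℕ) → Set
LeibnizEntry L a b c = c * rising a (suc b) ≡ L * b !

module _ {L N : ℕ} (1≤i≤N⇒i∣L : ∀ {i} → 1 ≤ i → i ≤ N → i ℕ.∣ L) where

  private
    -- `left` and `top` bring two neighbouring entries over the common denominator
    -- `rising a (suc (suc b))`, so that the recurrence of the triangle becomes one between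
    -- numerators.
    left : ∀ a b c → LeibnizEntry L (suc a) b c →
           c * rising a (suc (suc b)) ≡ suc a * (L * b !)
    left a b c eq = begin
      c * (suc a * rising (suc a) (suc b))  ≡⟨ x∙yz≈y∙xz c (suc a) _ ⟩
      suc a * (c * rising (suc a) (suc b))  ≡⟨ cong (suc a *_) eq ⟩
      suc a * (L * b !)                     ∎
      where open ≡-Reasoning

    top : ∀ a b c → LeibnizEntry L a b c →
          c * rising a (suc (suc b)) ≡ suc (a + suc b) * (L * b !)
    top a b c eq = begin
      c * rising a (suc (suc b))              ≡⟨ cong (c *_) (rising-snoc a (suc b)) ⟩
      c * (rising a (suc b) * suc (a + suc b)) ≡⟨ *-assoc c _ _ ⟨
      c * rising a (suc b) * suc (a + suc b)   ≡⟨ *-comm (c * rising a (suc b)) _ ⟩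
      suc (a + suc b) * (c * rising a (suc b)) ≡⟨ cong (suc (a + suc b) *_) eq ⟩
      suc (a + suc b) * (L * b !)              ∎
      where open ≡-Reasoning

    sucs : ∀ a b → suc (a + suc b) ≡ suc b + suc a
    sucs = solve-∀

    m+1+n≡N⇒m<N : ∀ {m n} → m + suc n ≡ N → m < N
    m+1+n≡N⇒m<N eq = subst (_ <_) eq (m<m+n _ z<s)

    suc-fact : ∀ b → L * suc b ! ≡ suc b * (L * b !)
    suc-fact b = x∙yz≈y∙xz L (suc b) (b !)

    shift₁ : ∀ a b d → suc a + b + suc d ≡ a + b + suc (suc d)
    shift₁ = solve-∀

    shift₂ : ∀ a b d → a + suc b + suc d ≡ a + b + suc (suc d)
    shift₂ = solve-∀

  -- Integrality spreads from the edge b = 0, where the entry L / (a + 1) is an integer because a +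
  -- 1 ≤ N: each further entry is the difference of two entries with smaller b.
  leibniz-entry : ∀ b a → a + b < N → ∃[ c ] LeibnizEntry L a b c
  leibniz-entry zero a a+b<N
    with ℕ.divides c eq ← 1≤i≤N⇒i∣L {suc a} z<s (≤-trans (s≤s (m≤m+n a 0)) a+b<N) =
    c , trans (cong (c *_) (*-identityʳ (suc a))) (trans (sym eq) (sym (*-identityʳ L)))
  leibniz-entry (suc b) a a+b<N
    with c , eq ← leibniz-entry b a (<-trans (+-monoʳ-< a (n<1+n b)) a+b<N)
       | c′ , eq′ ← leibniz-entry b (suc a) (subst (_< N) (+-suc a b) a+b<N) =
    c ∸ c′ , (begin
      (c ∸ c′) * R                                      ≡⟨ *-distribʳ-∸ R c c′ ⟩
      c * R ∸ c′ * R                                    ≡⟨ cong₂ _∸_ (top a b c eq) (left a b c′ eq′) ⟩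
      suc (a + suc b) * X ∸ suc a * X                   ≡⟨ *-distribʳ-∸ X (suc (a + suc b)) (suc a) ⟨
      (suc (a + suc b) ∸ suc a) * X                     ≡⟨ cong (λ d → (d ∸ suc a) * X) (sucs a b) ⟩
      (suc b + suc a ∸ suc a) * X                       ≡⟨ cong (_* X) (m+n∸n≡m (suc b) (suc a)) ⟩
      suc b * X                                         ≡⟨ suc-fact b ⟨
      L * suc b !                                       ∎)
    where
    open ≡-Reasoning
    R X : ℕ
    R = rising a (suc (suc b))
    X = L * b !

  -- Every entry is the sum of the two entries below it, so it is at least
  -- the number of paths to the bottom row.
  leibniz-entry-≥ : 0 < L → ∀ d {a b c} → a + b + suc d ≡ N →
                    LeibnizEntry L a b c → 2 ^ d ≤ c
  leibniz-entry-≥ L>0 zero {a} {b} {zero} _ eq =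
    contradiction (sym eq) (>⇒≢ (*-mono-< L>0 (1≤n! b)))
  leibniz-entry-≥ L>0 zero {c = suc c} _ eq = s≤s z≤n
  leibniz-entry-≥ L>0 (suc d) {a} {b} {c} size eq
    with c₁ , eq₁ ← leibniz-entry b (suc a) (m+1+n≡N⇒m<N (trans (shift₁ a b d) size))
       | c₂ , eq₂ ← leibniz-entry (suc b) a (m+1+n≡N⇒m<N (trans (shift₂ a b d) size)) = begin
    2 ^ d + (2 ^ d + 0)  ≡⟨ cong (λ z → 2 ^ d + z) (+-identityʳ (2 ^ d)) ⟩
    2 ^ d + 2 ^ d        ≤⟨ +-mono-≤ (leibniz-entry-≥ L>0 d {suc a} {b} {c₁} (trans (shift₁ a b d) size) eq₁)
                                     (leibniz-entry-≥ L>0 d {a} {suc b} {c₂} (trans (shift₂ a b d) size) eq₂) ⟩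
    c₁ + c₂              ≡⟨ *-cancelʳ-≡ (c₁ + c₂) c R {{>-nonZero (rising>0 a (suc (suc b)))}} split ⟩
    c                    ∎
    where
    open ≤-Reasoning
    R X : ℕ
    R = rising a (suc (suc b))
    X = L * b !
    split : (c₁ + c₂) * R ≡ c * R
    split = ≡.begin
      (c₁ + c₂) * R              ≡.≡⟨ *-distribʳ-+ R c₁ c₂ ⟩
      c₁ * R + c₂ * R            ≡.≡⟨ cong₂ _+_ (left a b c₁ eq₁) (trans eq₂ (suc-fact b)) ⟩
      suc a * X + suc b * X      ≡.≡⟨ *-distribʳ-+ X (suc a) (suc b) ⟨
      (suc a + suc b) * X        ≡.≡⟨ cong (_* X) (trans (+-comm (suc a) (suc b)) (sym (sucs a b))) ⟩
      suc (a + suc b) * X        ≡.≡⟨ top a b c eq ⟨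
      c * R                      ≡.∎
      where module ≡ = ≡-Reasoning

-- The apex of the triangle is L itself, and it lies N rows above the bottom.
common-multiple-≥ : ∀ {L} N → 0 < L → (∀ {i} → 1 ≤ i → i ≤ suc N → i ℕ.∣ L) → 2 ^ N ≤ L
common-multiple-≥ {L} N L>0 div = leibniz-entry-≥ div L>0 N {0} {0} refl refl

∑from : (ℕ → ℕ) → ℕ → ℕ → ℕ
∑from g a zero    = 0
∑from g a (suc l) = g a + ∑from g (suc a) l

∑from-snoc : ∀ g a l → ∑from g a (suc l) ≡ ∑from g a l + g (a + l)
∑from-snoc g a zero    rewrite +-identityʳ a = +-identityʳ (g a)
∑from-snoc g a (suc l) rewrite +-suc a l =
  trans (cong (λ z → g a + z) (∑from-snoc g (suc a) l)) (sym (+-assoc (g a) _ _))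

primeBit : ℕ → ℕ
primeBit m = bit (does (prime? m))

π : ℕ → ℕ
π N = ∑from primeBit 1 N

n<m^n : ∀ {m} → 2 ≤ m → ∀ n → n < m ^ n
n<m^n {m} 2≤m zero    = z<s
n<m^n {m} 2≤m (suc n) = begin-strict
  suc n              ≤⟨ n<m^n 2≤m n ⟩
  m ^ n              <⟨ m<m+n (m ^ n) (≤-<-trans z≤n (n<m^n 2≤m n)) ⟩
  m ^ n + m ^ n      ≡⟨ cong (λ z → m ^ n + z) (+-identityʳ (m ^ n)) ⟨
  2 * m ^ n          ≤⟨ *-monoˡ-≤ (m ^ n) 2≤m ⟩
  m * m ^ n          ∎
  where open ≤-Reasoning

-- P is the greatest power of q not exceeding N. Exponents up to N suffice in the search, since a <
-- q ^ a.
largest-power : ∀ {q N} → 2 ≤ q → 1 ≤ N →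
                ∃[ P ] (1 ≤ P × P ≤ N × (∀ a → q ^ a ≤ N → q ^ a ℕ.∣ P))
largest-power {q} {N} 2≤q 1≤N with search N
  where
  search : ∀ e → ∃[ P ] (1 ≤ P × P ≤ N × (∀ {a} → a ≤ e → q ^ a ≤ N → q ^ a ℕ.∣ P))
  search zero = 1 , ≤-refl , 1≤N , λ { z≤n _ → ℕ.∣-refl }
  search (suc e) with q ^ suc e ≤? N
  ... | yes q^1+e≤N = q ^ suc e , ≤-<-trans z≤n (n<m^n 2≤q (suc e)) , q^1+e≤N ,
                      λ a≤1+e _ → ^-monoʳ-∣ a≤1+e
    where
    ^-monoʳ-∣ : ∀ {a b} → a ≤ b → q ^ a ℕ.∣ q ^ b
    ^-monoʳ-∣ {a} {b} a≤b = ℕ.divides (q ^ (b ∸ a)) (trans (cong (q ^_) (sym (m∸n+n≡m a≤b))) (^-distribˡ-+-* q (b ∸ a) a))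
  ... | no q^1+e≰N with P , 1≤P , P≤N , div ← search e =
    P , 1≤P , P≤N , λ {a} a≤1+e q^a≤N → case m≤n⇒m<n∨m≡n a≤1+e of λ where
      (inj₁ (s≤s a≤e)) → div a≤e q^a≤N
      (inj₂ refl)      → contradiction q^a≤N q^1+e≰N
... | P , 1≤P , P≤N , div =
  P , 1≤P , P≤N , λ a q^a≤N → div (<⇒≤ (<-≤-trans (n<m^n 2≤q a) q^a≤N)) q^a≤N

extract-power : ∀ {q} → 2 ≤ q → ∀ m → 1 ≤ m →
                ∃[ a ] ∃[ m′ ] (1 ≤ m′ × q ℕ.∤ m′ × m ≡ m′ * q ^ a)
extract-power {q} 2≤q = <-rec _ go
  where
  go : ∀ m → (∀ {k} → k < m → 1 ≤ k → ∃[ a ] ∃[ m′ ] (1 ≤ m′ × q ℕ.∤ m′ × k ≡ m′ * q ^ a)) →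
       1 ≤ m → ∃[ a ] ∃[ m′ ] (1 ≤ m′ × q ℕ.∤ m′ × m ≡ m′ * q ^ a)
  go m rec 1≤m with q ℕ.∣? m
  ... | no q∤m = 0 , m , 1≤m , q∤m , sym (*-identityʳ m)
  ... | yes (ℕ.divides zero m≡0) = contradiction m≡0 (>⇒≢ 1≤m)
  ... | yes (ℕ.divides k@(suc _) m≡kq)
    with a , m′ , 1≤m′ , q∤m′ , eq ← rec (subst (k <_) (sym m≡kq) (m<m*n k q 2≤q)) z<s =
    suc a , m′ , 1≤m′ , q∤m′ , trans m≡kq (trans (cong (_* q) eq) (swap m′ (q ^ a) q))
    where
    swap : ∀ x y z → x * y * z ≡ x * (z * y)
    swap = solve-∀

-- The least common multiple is assembled from the primes in descending order: a prime M contributes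
-- its greatest power up to N, any other M contributes nothing. At M = 1 every m is rough.
rough-multiple : ∀ N → 1 ≤ N → ∀ l M → 1 ≤ M → M + l ≡ suc N →
  ∃[ L ] (1 ≤ L × L ≤ N ^ ∑from primeBit M l ×
          (∀ {m} → 1 ≤ m → m ≤ N → M Rough m → m ℕ.∣ L))
rough-multiple N 1≤N zero M 1≤M M≡1+N = 1 , ≤-refl , ≤-refl , rough⇒∣1
  where
  rough⇒∣1 : ∀ {m} → 1 ≤ m → m ≤ N → M Rough m → m ℕ.∣ 1
  rough⇒∣1 {1} _ _ _ = ℕ.∣-refl
  -- Here M = N + 1, and a rough number other than 1 would be at least M.
  rough⇒∣1 {suc (suc _)} _ m≤N rough =
    contradiction (≤-<-trans m≤N (subst (N <_) (sym (trans (sym (+-identityʳ M)) M≡1+N)) ≤-refl))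
                  (≤⇒≯ (rough⇒≤ rough))
rough-multiple N 1≤N (suc l) M 1≤M M+1+l≡1+N
  with L , 1≤L , L≤ , div ← rough-multiple N 1≤N l (suc M) z<s (trans (sym (+-suc M l)) M+1+l≡1+N)
     | prime? M
... | no ¬p = L , 1≤L , L≤ , λ 1≤m m≤N rough → div 1≤m m≤N (skip 1≤m rough)
  where
  skip : ∀ {m} → 1 ≤ m → M Rough m → suc M Rough m
  skip {m} 1≤m rough with M ≟ 1
  ... | yes refl = 2-rough
  -- A divisor of a rough number is rough, so if M divided m it would have no smaller nontrivial
  -- divisor and be prime.
  ... | no M≢1 = ∤⇒rough-suc (λ M∣m → ¬p (rough∧∣⇒prime {{n>1⇒nonTrivial (≤∧≢⇒< 1≤M (M≢1 ∘ sym))}} rough M∣m)) rough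
... | yes p
  with P , 1≤P , P≤N , powers ← largest-power {M} {N} (nonTrivial⇒n>1 M {{prime⇒nonTrivial p}}) 1≤N =
  L * P , *-mono-≤ 1≤L 1≤P , ≤-trans (*-mono-≤ L≤ P≤N) (≤-reflexive (*-comm _ N)) , both
  where
  both : ∀ {m} → 1 ≤ m → m ≤ N → M Rough m → m ℕ.∣ L * P
  both {m} 1≤m m≤N rough
    with a , m′ , 1≤m′ , M∤m′ , refl ← extract-power (nonTrivial⇒n>1 M {{prime⇒nonTrivial p}}) m 1≤m =
    -- In m = m′ · M^a the cofactor m′ is rough beyond M and divides L, while M^a divides P.
    ℕ.*-pres-∣ (div 1≤m′ (≤-trans (m≤m*n m′ (M ^ a) {{m^n≢0 M a {{prime⇒nonZero p}}}}) m≤N)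
                     (∤⇒rough-suc M∤m′ (rough∧∣⇒rough rough (ℕ.m∣m*n (M ^ a)))))
               (powers a (≤-trans (m≤n*m (M ^ a) m′ {{>-nonZero 1≤m′}}) m≤N))

chebyshev : ∀ N → 2 ^ N ≤ suc N ^ π (suc N)
chebyshev N with L , 1≤L , L≤ , div ← rough-multiple (suc N) z<s (suc N) 1 ≤-refl refl =
  ≤-trans (common-multiple-≥ N 1≤L (λ 1≤i i≤N → div 1≤i i≤N 1-rough)) L≤

-- Functions of low degree on the cube

*-distribʳ-minus : ∀ a b c → (a ℤ.- b) ℤ.* c ≡ a ℤ.* c ℤ.- b ℤ.* c
*-distribʳ-minus = ℤ-Solver.solve-∀

BoolFun : ℕ → Set
BoolFun N = Vec Bool N → ℤ

Δ : ∀ {N} → BoolFun (suc N) → BoolFun N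
Δ f y = f (true ∷ y) ℤ.- f (false ∷ y)

-- f agrees on {0,1}^N with a polynomial of degree strictly less than d.
Deg< : ∀ N → ℕ → BoolFun N → Set
Deg< N       zero    f = ∀ y → f y ≡ 0ℤ
Deg< zero    (suc d) f = ⊤
Deg< (suc N) (suc d) f = Deg< N d (Δ f) × Deg< N (suc d) (f ∘ (false ∷_))

Deg<-cong : ∀ {N} d {f g : BoolFun N} → (∀ y → f y ≡ g y) → Deg< N d f → Deg< N d g
Deg<-cong zero f≗g f≡0 y = trans (sym (f≗g y)) (f≡0 y)
Deg<-cong {zero} (suc d) f≗g _ = tt
Deg<-cong {suc N} (suc d) f≗g (Δf , f₀) =
  Deg<-cong d (λ y → cong₂ ℤ._-_ (f≗g (true ∷ y)) (f≗g (false ∷ y))) Δf ,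
  Deg<-cong (suc d) (f≗g ∘ (false ∷_)) f₀

Deg<-step : ∀ {N} d {f : BoolFun N} → Deg< N d f → Deg< N (suc d) f
Deg<-step {zero}  d       _ = tt
Deg<-step {suc N} zero    f≡0 =
  (λ y → cong₂ ℤ._-_ (f≡0 (true ∷ y)) (f≡0 (false ∷ y))) , Deg<-step zero (f≡0 ∘ (false ∷_))
Deg<-step {suc N} (suc d) (Δf , f₀) = Deg<-step d Δf , Deg<-step (suc d) f₀

Deg<-mono : ∀ {N d e} {f : BoolFun N} → d ≤ e → Deg< N d f → Deg< N e f
Deg<-mono {e = zero} z≤n df = df
Deg<-mono {d = d} {suc e} d≤e df with m≤n⇒m<n∨m≡n d≤e
... | inj₁ (s≤s d≤e′) = Deg<-step e (Deg<-mono d≤e′ df)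
... | inj₂ refl       = df

Deg<-const : ∀ N c → Deg< N 1 (λ _ → c)
Deg<-const zero    c = tt
Deg<-const (suc N) c = (λ _ → ℤ.+-inverseʳ c) , Deg<-const N c

Deg<-+ : ∀ {N} d {f g : BoolFun N} → Deg< N d f → Deg< N d g → Deg< N d (λ y → f y ℤ.+ g y)
Deg<-+ zero f≡0 g≡0 y = cong₂ ℤ._+_ (f≡0 y) (g≡0 y)
Deg<-+ {zero} (suc d) _ _ = tt
Deg<-+ {suc N} (suc d) {f} {g} (Δf , f₀) (Δg , g₀) =
  Deg<-cong d (λ y → rearrange (f (true ∷ y)) (f (false ∷ y)) (g (true ∷ y)) (g (false ∷ y))) (Deg<-+ d Δf Δg) ,
  Deg<-+ (suc d) f₀ g₀
  where
  rearrange : ∀ a b c d → a ℤ.- b ℤ.+ (c ℤ.- d) ≡ a ℤ.+ c ℤ.- (b ℤ.+ d)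
  rearrange = ℤ-Solver.solve-∀

Deg<-scale : ∀ {N} d c {f : BoolFun N} → Deg< N d f → Deg< N d (λ y → f y ℤ.* c)
Deg<-scale zero c f≡0 y = cong (ℤ._* c) (f≡0 y)
Deg<-scale {zero} (suc d) c _ = tt
Deg<-scale {suc N} (suc d) c {f} (Δf , f₀) =
  Deg<-cong d (λ y → *-distribʳ-minus (f (true ∷ y)) (f (false ∷ y)) c) (Deg<-scale d c Δf) ,
  Deg<-scale (suc d) c f₀

-- The slopes are natural numbers, as the functions in question are weighted sums with natural
-- weights.
Affine : ∀ {N} → (Vec Bool N → ℕ) → Set
Affine {zero}  g = ⊤
Affine {suc N} g = (∃[ w ] (∀ y → g (true ∷ y) ≡ g (false ∷ y) + w)) × Affine (g ∘ (false ∷_))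

-- Quantifying over f makes degree bounds compose, so a product of many factors is handled one
-- factor at a time.
Raises : ∀ {N} → ℕ → BoolFun N → Set
Raises {N} e g = ∀ d {f : BoolFun N} → Deg< N d f → Deg< N (e + d) (λ y → f y ℤ.* g y)

-- With f₀, f₁ and g₀ the restrictions to first bit 0, 1 and 0, the Leibniz rule reads Δ(f · (g -
-- u)) = Δf · (g₀ - u) + f₁ · w. The first term is covered by induction; the second is a constant
-- multiple of f₁ = Δf + f₀.
affine-raises : ∀ {N} {g : Vec Bool N → ℕ} → Affine g → ∀ u → Raises 1 (λ y → + g y ℤ.- + u)
affine-raises {zero}  _ u d _ = tt
affine-raises {suc N} {g} ((w , g₁≗g₀+w) , g₀) u zero {f} f≡0 =
  Deg<-step zero λ y → cong (ℤ._* (+ g y ℤ.- + u)) (f≡0 y)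
affine-raises {suc N} {g} ((w , g₁≗g₀+w) , g₀) u (suc d) {f} (Δf , f₀) =
  Deg<-cong (suc d) leibniz
    (Deg<-+ (suc d) (affine-raises g₀ u d Δf)
                    (Deg<-scale (suc d) (+ w) (Deg<-+ (suc d) (Deg<-step d Δf) f₀))) ,
  affine-raises g₀ u (suc d) f₀
  where
  expand : ∀ a b x u w → (a ℤ.- b) ℤ.* (x ℤ.- u) ℤ.+ (a ℤ.- b ℤ.+ b) ℤ.* w ≡
                         a ℤ.* (x ℤ.+ w ℤ.- u) ℤ.- b ℤ.* (x ℤ.- u)
  expand = ℤ-Solver.solve-∀
  leibniz : ∀ y → Δ f y ℤ.* (+ g (false ∷ y) ℤ.- + u) ℤ.+ (Δ f y ℤ.+ f (false ∷ y)) ℤ.* + w ≡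
                  f (true ∷ y) ℤ.* (+ g (true ∷ y) ℤ.- + u) ℤ.- f (false ∷ y) ℤ.* (+ g (false ∷ y) ℤ.- + u)
  leibniz y = trans (expand (f (true ∷ y)) (f (false ∷ y)) (+ g (false ∷ y)) (+ u) (+ w))
    (cong (λ z → f (true ∷ y) ℤ.* (z ℤ.- + u) ℤ.- f (false ∷ y) ℤ.* (+ g (false ∷ y) ℤ.- + u))
          (cong +_ (sym (g₁≗g₀+w y))))

∏-raises : ∀ {N m} (e : Vector ℕ m) (g : Fin m → BoolFun N) → (∀ i → Raises (e i) (g i)) →
           Raises (sum e) (λ y → ∏ (λ i → g i y))
∏-raises {m = zero}  e g r d df = Deg<-cong d (λ y → sym (ℤ.*-identityʳ _)) df
∏-raises {m = suc m} e g r d {f} df =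
  subst (λ k → Deg< _ k (λ y → f y ℤ.* ∏ (λ i → g i y)))
    (trans (sym (+-assoc (sum (e ∘ suc)) (e zero) d)) (cong (_+ d) (+-comm (sum (e ∘ suc)) (e zero))))
    (Deg<-cong (sum (e ∘ suc) + (e zero + d)) (λ y → ℤ.*-assoc (f y) (g zero y) _)
      (∏-raises (e ∘ suc) (g ∘ suc) (r ∘ suc) (e zero + d) (r zero d df)))

∏≡0 : ∀ {m} (g : Fin m → ℤ) i → g i ≡ 0ℤ → ∏ g ≡ 0ℤ
∏≡0 g zero    eq = cong (ℤ._* ∏ (g ∘ suc)) eq
∏≡0 g (suc i) eq = trans (cong (g zero ℤ.*_) (∏≡0 (g ∘ suc) i eq)) (ℤ.*-zeroʳ (g zero))

-- Prime divisors of integer products, and sums over slices of the cube.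

prime∤1 : ∀ {p} → Prime p → p ℕ.∤ 1
prime∤1 pr p∣1 = ¬prime[1] (subst Prime (ℕ.∣1⇒≡1 p∣1) pr)

prime∣* : ∀ {p} → Prime p → ∀ a b → + p ∣ a ℤ.* b → + p ∣ a ⊎ + p ∣ b
prime∣* {p} pr a b p∣ab with euclidsLemma ℤ.∣ a ∣ ℤ.∣ b ∣ pr (subst (p ℕ.∣_) (ℤ.abs-* a b) (∣⇒∣ᵤ p∣ab))
... | inj₁ p∣a = inj₁ (∣ᵤ⇒∣ p∣a)
... | inj₂ p∣b = inj₂ (∣ᵤ⇒∣ p∣b)

prime∣∏ : ∀ {p} → Prime p → ∀ {m} (g : Fin m → ℤ) → + p ∣ ∏ g → ∃[ i ] + p ∣ g i
prime∣∏ pr {zero}  g p∣1 = contradiction (∣⇒∣ᵤ p∣1) (prime∤1 pr)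
prime∣∏ pr {suc m} g p∣∏ with prime∣* pr (g zero) _ p∣∏
... | inj₁ p∣g0 = zero , p∣g0
... | inj₂ p∣∏′ with i , p∣gi ← prime∣∏ pr (g ∘ suc) p∣∏′ = suc i , p∣gi

-- ∑ over y ∈ {0,1}^N of f(y) · C(m, r − z), z the number of zeros of y: the sum
-- of f over the points of {0,1}^(N + m) with exactly r zeros.
sliceSum : ∀ {N} → BoolFun N → ℕ → ℕ → ℤ
sliceSum {zero}  f m r       = f [] ℤ.* + (m choose r)
sliceSum {suc N} f m zero    = sliceSum (f ∘ (true ∷_)) m zero
sliceSum {suc N} f m (suc r) = sliceSum (f ∘ (true ∷_)) m (suc r) ℤ.+ sliceSum (f ∘ (false ∷_)) m r

-- Without zeros only the all-ones point remains, and C(m, 0) = 1 for every m.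
sliceSum-0 : ∀ {N} (f : BoolFun N) m → sliceSum f (suc m) 0 ≡ sliceSum f m 0
sliceSum-0 {zero}  f m = refl
sliceSum-0 {suc N} f m = sliceSum-0 (f ∘ (true ∷_)) m

-- Pascal's rule: one of the m + 1 coordinates that f does not read is either 1 or 0.
sliceSum-pascal : ∀ {N} (f : BoolFun N) m r →
                  sliceSum f m (suc r) ℤ.+ sliceSum f m r ≡ sliceSum f (suc m) (suc r)
sliceSum-pascal {zero} f m r = begin
  f [] ℤ.* + (m choose suc r) ℤ.+ f [] ℤ.* + (m choose r)  ≡⟨ ℤ.*-distribˡ-+ (f []) (+ (m choose suc r)) (+ (m choose r)) ⟨
  f [] ℤ.* + (m choose suc r + m choose r)                 ≡⟨ cong (λ c → f [] ℤ.* + c) (+-comm (m choose suc r) (m choose r)) ⟩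
  f [] ℤ.* + (m choose r + m choose suc r)                 ≡⟨ cong (λ c → f [] ℤ.* + c) (nCk+nC[k+1]≡[n+1]C[k+1] m r) ⟩
  f [] ℤ.* + (suc m choose suc r)                     ∎
  where open ≡-Reasoning
sliceSum-pascal {suc N} f m zero = begin
  a ℤ.+ b ℤ.+ c                        ≡⟨ swap a b c ⟩
  (a ℤ.+ c) ℤ.+ b                      ≡⟨ cong₂ ℤ._+_ (sliceSum-pascal (f ∘ (true ∷_)) m 0)
                                                       (sym (sliceSum-0 (f ∘ (false ∷_)) m)) ⟩
  sliceSum f (suc m) 1                 ∎
  where
  open ≡-Reasoning
  a b c : ℤ
  a = sliceSum (f ∘ (true ∷_)) m 1
  b = sliceSum (f ∘ (false ∷_)) m 0
  c = sliceSum (f ∘ (true ∷_)) m 0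
  swap : ∀ a b c → a ℤ.+ b ℤ.+ c ≡ a ℤ.+ c ℤ.+ b
  swap = ℤ-Solver.solve-∀
sliceSum-pascal {suc N} f m (suc r) = begin
  (a ℤ.+ b) ℤ.+ (c ℤ.+ d)              ≡⟨ swap a b c d ⟩
  (a ℤ.+ c) ℤ.+ (b ℤ.+ d)              ≡⟨ cong₂ ℤ._+_ (sliceSum-pascal (f ∘ (true ∷_)) m (suc r))
                                                       (sliceSum-pascal (f ∘ (false ∷_)) m r) ⟩
  sliceSum f (suc m) (suc (suc r))     ∎
  where
  open ≡-Reasoning
  a b c d : ℤ
  a = sliceSum (f ∘ (true ∷_)) m (suc (suc r))
  b = sliceSum (f ∘ (false ∷_)) m (suc r)
  c = sliceSum (f ∘ (true ∷_)) m (suc r)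
  d = sliceSum (f ∘ (false ∷_)) m r
  swap : ∀ a b c d → (a ℤ.+ b) ℤ.+ (c ℤ.+ d) ≡ (a ℤ.+ c) ℤ.+ (b ℤ.+ d)
  swap = ℤ-Solver.solve-∀

sliceSum-minus : ∀ {N} (f g : BoolFun N) m r →
             sliceSum (λ y → f y ℤ.- g y) m r ≡ sliceSum f m r ℤ.- sliceSum g m r
sliceSum-minus {zero} f g m r = *-distribʳ-minus (f []) (g []) (+ (m choose r))
sliceSum-minus {suc N} f g m zero = sliceSum-minus (f ∘ (true ∷_)) (g ∘ (true ∷_)) m zero
sliceSum-minus {suc N} f g m (suc r) =
  trans (cong₂ ℤ._+_ (sliceSum-minus (f ∘ (true ∷_)) (g ∘ (true ∷_)) m (suc r))
                     (sliceSum-minus (f ∘ (false ∷_)) (g ∘ (false ∷_)) m r))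
        (swap (sliceSum (f ∘ (true ∷_)) m (suc r)) (sliceSum (g ∘ (true ∷_)) m (suc r))
              (sliceSum (f ∘ (false ∷_)) m r) (sliceSum (g ∘ (false ∷_)) m r))
  where
  swap : ∀ a b c d → a ℤ.- b ℤ.+ (c ℤ.- d) ≡ a ℤ.+ c ℤ.- (b ℤ.+ d)
  swap = ℤ-Solver.solve-∀

-- Write f = x · Δf + f₀ in the first coordinate x. The first term lives on x = 1; the second
-- ignores x, which joins the m unread coordinates.
sliceSum-split : ∀ {N} (f : BoolFun (suc N)) m r →
                 sliceSum f m r ≡ sliceSum (Δ f) m r ℤ.+ sliceSum (f ∘ (false ∷_)) (suc m) r
sliceSum-split f m zero = begin
  a                                      ≡⟨ cancel a b ⟩
  (a ℤ.- b) ℤ.+ b                        ≡⟨ cong₂ ℤ._+_ (sliceSum-minus f₁ f₀ m 0) (sliceSum-0 f₀ m) ⟨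
  sliceSum (Δ f) m 0 ℤ.+ sliceSum f₀ (suc m) 0 ∎
  where
  open ≡-Reasoning
  f₁ = f ∘ (true ∷_)
  f₀ = f ∘ (false ∷_)
  a = sliceSum f₁ m 0
  b = sliceSum f₀ m 0
  cancel : ∀ a b → a ≡ (a ℤ.- b) ℤ.+ b
  cancel = ℤ-Solver.solve-∀
sliceSum-split f m (suc r) = begin
  a ℤ.+ c                                ≡⟨ cancel a b c ⟩
  (a ℤ.- b) ℤ.+ (b ℤ.+ c)                ≡⟨ cong₂ ℤ._+_ (sym (sliceSum-minus f₁ f₀ m (suc r))) (sliceSum-pascal f₀ m r) ⟩
  sliceSum (Δ f) m (suc r) ℤ.+ sliceSum f₀ (suc m) (suc r) ∎
  where
  open ≡-Reasoning
  f₁ = f ∘ (true ∷_)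
  f₀ = f ∘ (false ∷_)
  a = sliceSum f₁ m (suc r)
  b = sliceSum f₀ m (suc r)
  c = sliceSum f₀ m r
  cancel : ∀ a b c → a ℤ.+ c ≡ (a ℤ.- b) ℤ.+ (b ℤ.+ c)
  cancel = ℤ-Solver.solve-∀

sliceSum-≡0 : ∀ {N} {f : BoolFun N} → (∀ y → f y ≡ 0ℤ) → ∀ m r → sliceSum f m r ≡ 0ℤ
sliceSum-≡0 {zero} f≡0 m r = cong (ℤ._* + (m choose r)) (f≡0 [])
sliceSum-≡0 {suc N} f≡0 m zero = sliceSum-≡0 (f≡0 ∘ (true ∷_)) m zero
sliceSum-≡0 {suc N} f≡0 m (suc r) =
  cong₂ ℤ._+_ (sliceSum-≡0 (f≡0 ∘ (true ∷_)) m (suc r)) (sliceSum-≡0 (f≡0 ∘ (false ∷_)) m r)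

-- The expansion of f into monomials: a monomial of degree t contributes its
-- coefficient times C(N + m − t, r).
∣-sliceSum : ∀ {N q r} d m {f : BoolFun N} → Deg< N d f →
             (∀ {n} → N + m < n + d → n ≤ N + m → q ∣ + (n choose r)) → q ∣ sliceSum f m r
∣-sliceSum {q = q} {r} zero m f≡0 div = subst (q ∣_) (sym (sliceSum-≡0 f≡0 m r)) (divides 0ℤ refl)
∣-sliceSum {zero} (suc d) m {f} _ div = ∣n⇒∣m*n (f []) (div (m<m+n m z<s) ≤-refl)
∣-sliceSum {suc N} {q} {r} (suc d) m {f} (Δf , f₀) div = subst (q ∣_) (sym (sliceSum-split f m r))
  (∣m∣n⇒∣m+n
    (∣-sliceSum d m Δf λ {n} lo hi → div (subst (suc (N + m) <_) (sym (+-suc n d)) (s<s lo)) (m≤n⇒m≤1+n hi))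
    (∣-sliceSum (suc d) (suc m) f₀ λ {n} → subst (λ k → k < n + suc d → n ≤ k → q ∣ + (n choose r)) (sym (+-suc N m)) div))

origin : ∀ N → Vec Bool N
origin N = replicate N false

-- The same expansion with the constant monomial set apart: its coefficient is the value of f at the
-- origin. Only monomials of degree 1 to d must contribute multiples of q, hence n < N + m.
∣-sliceSum-origin : ∀ {N q r} d m {f : BoolFun N} → Deg< N (suc d) f →
                    (∀ {n} → N + m ≤ n + d → n < N + m → q ∣ + (n choose r)) →
                    q ∣ sliceSum f m r ℤ.- f (origin N) ℤ.* + ((N + m) choose r)
∣-sliceSum-origin {zero} {q} {r} d m {f} _ div = subst (q ∣_) (sym (ℤ.+-inverseʳ (f [] ℤ.* + (m choose r)))) (divides 0ℤ refl)
∣-sliceSum-origin {suc N} {q} {r} d m {f} (Δf , f₀) div = subst (q ∣_) regroup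
  (∣m∣n⇒∣m+n
    (∣-sliceSum d m Δf λ lo hi → div lo (s≤s hi))
    (∣-sliceSum-origin d (suc m) f₀ λ {n} → subst (λ k → k ≤ n + d → n < k → q ∣ + (n choose r)) (sym (+-suc N m)) div))
  where
  assoc : ∀ a b c → a ℤ.+ (b ℤ.- c) ≡ a ℤ.+ b ℤ.- c
  assoc = ℤ-Solver.solve-∀
  s₁ s₀ : ℤ
  s₁ = sliceSum (Δ f) m r
  s₀ = sliceSum (f ∘ (false ∷_)) (suc m) r
  regroup : s₁ ℤ.+ (s₀ ℤ.- f (origin (suc N)) ℤ.* + ((N + suc m) choose r)) ≡
            sliceSum f m r ℤ.- f (origin (suc N)) ℤ.* + ((suc N + m) choose r)
  regroup = trans (assoc s₁ s₀ _)
    (cong₂ (λ s n → s ℤ.- f (origin (suc N)) ℤ.* + (n choose r)) (sym (sliceSum-split f m r)) (+-suc N m))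

-- Binomial coefficients modulo p, and functions vanishing on a slice.

prime∤! : ∀ {p} → Prime p → ∀ {k} → k < p → p ℕ.∤ k !
prime∤! pr {zero} k<p p∣1 = contradiction p∣1 (prime∤1 pr)
prime∤! pr {suc k} k<p p∣k! with euclidsLemma (suc k) (k !) pr p∣k!
... | inj₁ p∣k = ≤⇒≯ (ℕ.∣⇒≤ p∣k) k<p
... | inj₂ p∣k! = prime∤! pr (<-trans (n<1+n k) k<p) p∣k!

prime∣pCr : ∀ {p r} → Prime p → 0 < r → r < p → p ℕ.∣ p choose r
prime∣pCr {p@(suc p-1)} {r} pr 0<r r<p =
  [ id , [ (λ p∣r! → contradiction p∣r! (prime∤! pr r<p))
         , (λ p∣[p-r]! → contradiction p∣[p-r]! (prime∤! pr (∸-monoʳ-< 0<r (<⇒≤ r<p)))) ]′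
         ∘ euclidsLemma (r !) ((p ∸ r) !) pr ]′
  (euclidsLemma (p choose r) (r ! * (p ∸ r) !) pr (subst (p ℕ.∣_) (sym nCk*k![n-k]!≡n!) (ℕ.m∣m*n (p-1 !))))
  where
  instance _ = r !* (p ∸ r) !≢0
  nCk*k![n-k]!≡n! : (p choose r) * (r ! * (p ∸ r) !) ≡ p !
  nCk*k![n-k]!≡n! = trans (cong (_* (r ! * (p ∸ r) !)) (nCk≡n!/k![n-k]! (<⇒≤ r<p))) (m/n*n≡m (k![n∸k]!∣n! (<⇒≤ r<p)))

-- A case of Lucas' theorem, reached from C(p, r) by Pascal's rule.
prime∣[p+s]Cr : ∀ {p} → Prime p → ∀ s {r} → s < r → r < p → p ℕ.∣ (p + s) choose r
prime∣[p+s]Cr {p} pr zero    s<r r<p rewrite +-identityʳ p = prime∣pCr pr s<r r<p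
prime∣[p+s]Cr {p} pr (suc s) {suc r} (s<s s<r) r<p =
  subst (p ℕ.∣_) (trans (nCk+nC[k+1]≡[n+1]C[k+1] (p + s) r) (cong (_choose suc r) (sym (+-suc p s))))
    (ℕ.∣m∣n⇒∣m+n (prime∣[p+s]Cr pr s s<r (<-trans (n<1+n r) r<p)) (prime∣[p+s]Cr pr s (m<n⇒m<1+n s<r) r<p))

-- In Pascal's rule for C(p + r + 1, r + 1) the summand C(p + r, r + 1) is 0 modulo p, so the
-- residue is that of C(p, 0) = 1.
prime∤[p+r]Cr : ∀ {p} → Prime p → ∀ r → r < p → p ℕ.∤ (p + r) choose r
prime∤[p+r]Cr pr zero r<p p∣1 = contradiction p∣1 (prime∤1 pr)
prime∤[p+r]Cr {p} pr (suc r) r<p p∣C = prime∤[p+r]Cr pr r (<-trans (n<1+n r) r<p)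
  (ℕ.∣m+n∣m⇒∣n
    (subst (p ℕ.∣_)
      (sym (trans (+-comm ((p + r) choose suc r) _)
        (trans (nCk+nC[k+1]≡[n+1]C[k+1] (p + r) r) (cong (_choose suc r) (sym (+-suc p r)))))) p∣C)
    (prime∣[p+s]Cr pr r (n<1+n r) r<p))

zeros : ∀ {N} → Vec Bool N → ℕ
zeros []          = 0
zeros (true ∷ y)  = zeros y
zeros (false ∷ y) = suc (zeros y)

-- For m = 0 the weight C(0, r - z) is 0 off the slice z = r.
sliceSum-vanishing : ∀ {N} (f : BoolFun N) r → (∀ y → zeros y ≡ r → f y ≡ 0ℤ) → sliceSum f 0 r ≡ 0ℤ
sliceSum-vanishing {zero}  f zero    van = cong (ℤ._* + 1) (van [] refl)
sliceSum-vanishing {zero}  f (suc r) van = ℤ.*-zeroʳ (f [])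
sliceSum-vanishing {suc N} f zero    van = sliceSum-vanishing (f ∘ (true ∷_)) zero (van ∘ (true ∷_))
sliceSum-vanishing {suc N} f (suc r) van = cong₂ ℤ._+_
  (sliceSum-vanishing (f ∘ (true ∷_)) (suc r) (van ∘ (true ∷_)))
  (sliceSum-vanishing (f ∘ (false ∷_)) r λ y eq → van (false ∷ y) (cong suc eq))

-- Modulo p, the sum of f over the slice is C(p + r, r) · f(0, …, 0), and the
-- binomial coefficient is invertible.
hegedus : ∀ {p r} → Prime p → r < p → {f : BoolFun (p + r)} → Deg< (p + r) (suc r) f →
          (∀ y → zeros y ≡ r → f y ≡ 0ℤ) → + p ∣ f (origin (p + r))
hegedus {p} {r} pr r<p {f} df van =
  [ id , (λ p∣C → contradiction (∣⇒∣ᵤ p∣C) (prime∤[p+r]Cr pr r r<p)) ]′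
  (prime∣* pr (f (origin (p + r))) (+ ((p + r) choose r)) p∣f*C)
  where
  -- The indices in question are n = p + s with s < r, where p divides C(n, r).
  div : ∀ {n} → p + r + 0 ≤ n + r → n < p + r + 0 → + p ∣ + (n choose r)
  div {n} lo hi = ∣ᵤ⇒∣ (subst (λ k → p ℕ.∣ k choose r) (m+[n∸m]≡n p≤n)
    (prime∣[p+s]Cr pr (n ∸ p) (+-cancelˡ-< p _ _ (subst₂ _<_ (sym (m+[n∸m]≡n p≤n)) (+-identityʳ (p + r)) hi)) r<p))
    where
    p≤n : p ≤ n
    p≤n = +-cancelʳ-≤ r p n (subst (_≤ n + r) (+-identityʳ (p + r)) lo)
  neg : ∀ x → 0ℤ ℤ.- (0ℤ ℤ.- x) ≡ x
  neg = ℤ-Solver.solve-∀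
  p∣f*C : + p ∣ f (origin (p + r)) ℤ.* + ((p + r) choose r)
  p∣f*C = subst (+ p ∣_) (neg _)
    (∣m∣n⇒∣m-n {m = 0ℤ} (divides 0ℤ refl)
      (subst₂ (λ s n → + p ∣ s ℤ.- f (origin (p + r)) ℤ.* + (n choose r)) (sliceSum-vanishing f r van) (+-identityʳ (p + r))
        (∣-sliceSum-origin r 0 df div)))

-- Circuits

sum-mono-≤ : ∀ {n} {f g : Vector ℕ n} → (∀ i → f i ≤ g i) → sum f ≤ sum g
sum-mono-≤ {zero}  f≤g = z≤n
sum-mono-≤ {suc n} f≤g = +-mono-≤ (f≤g zero) (sum-mono-≤ (f≤g ∘ suc))

sum-const : ∀ n c → ∑[ i < n ] c ≡ n * c
sum-const zero    c = refl
sum-const (suc n) c = cong (λ s → c + s) (sum-const n c)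

term≤sum : ∀ {n} (f : Vector ℕ n) i → f i ≤ sum f
term≤sum f zero    = m≤m+n (f zero) _
term≤sum f (suc i) = ≤-trans (term≤sum (f ∘ suc) i) (m≤n+m _ (f zero))

bit≤1 : ∀ b → bit b ≤ 1
bit≤1 true  = ≤-refl
bit≤1 false = z≤n

-- The bits past the end of the vector are 0.
at : ∀ {N} → Vec Bool N → ℕ → Bool
at []      l       = false
at (b ∷ y) zero    = b
at (b ∷ y) (suc l) = at y l

after-ones : ∀ i {N} → Vec Bool N → ℕ → Bool
after-ones i y = at (replicate i true ++ y)

at-origin : ∀ N l → at (origin N) l ≡ false
at-origin zero    l       = refl
at-origin (suc N) zero    = refl
at-origin (suc N) (suc l) = at-origin N l

after-ones-0 : ∀ i N l → after-ones i (false ∷ origin N) l ≡ (l <ᵇ i)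
after-ones-0 zero    N zero    = refl
after-ones-0 zero    N (suc l) = at-origin N l
after-ones-0 (suc i) N zero    = refl
after-ones-0 (suc i) N (suc l) = after-ones-0 i N l

after-ones-1 : ∀ i N l → after-ones i (true ∷ origin N) l ≡ (l <ᵇ suc i)
after-ones-1 zero    N zero    = refl
after-ones-1 zero    N (suc l) = at-origin N l
after-ones-1 (suc i) N zero    = refl
after-ones-1 (suc i) N (suc l) = after-ones-1 i N l

bit-after-ones : ∀ i {N} (y : Vec Bool N) l →
  bit (after-ones i (true ∷ y) l) ≡ bit (after-ones i (false ∷ y) l) + bit (l ≡ᵇ i)
bit-after-ones zero    y zero    = refl
bit-after-ones zero    y (suc l) = sym (+-identityʳ _)
bit-after-ones (suc i) y zero    = refl
bit-after-ones (suc i) y (suc l) = bit-after-ones i y l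

bit-chain : ∀ i l → bit (l <ᵇ suc i) ≡ bit (l <ᵇ i) + bit (l ≡ᵇ i)
bit-chain i l = trans (cong bit (sym (after-ones-1 i 0 l)))
  (trans (bit-after-ones i [] l) (cong (λ b → bit b + bit (l ≡ᵇ i)) (after-ones-0 i 0 l)))

ones : ∀ {N} → Vec Bool N → ℕ
ones []      = 0
ones (b ∷ y) = bit b + ones y

ones+zeros : ∀ {N} (y : Vec Bool N) → ones y + zeros y ≡ N
ones+zeros []          = refl
ones+zeros (true ∷ y)  = cong suc (ones+zeros y)
ones+zeros (false ∷ y) = trans (+-suc (ones y) (zeros y)) (cong suc (ones+zeros y))

ones-replicate-++ : ∀ i {N} (y : Vec Bool N) → ones (replicate i true ++ y) ≡ i + ones y
ones-replicate-++ zero    y = refl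
ones-replicate-++ (suc i) y = cong suc (ones-replicate-++ i y)

sum-at : ∀ {N} (y : Vec Bool N) {n} → N ≤ n → ∑[ l < n ] bit (at y (toℕ l)) ≡ ones y
sum-at []      {n}     _         = trans (sum-const n 0) (*-zeroʳ n)
sum-at (b ∷ y) {suc n} (s≤s N≤n) = cong (λ s → bit b + s) (sum-at y N≤n)

sum-indicator : ∀ n (l : Fin n) → ∑[ i < n ] bit (toℕ l ≡ᵇ toℕ i) ≡ 1
sum-indicator (suc n) zero    = cong suc (trans (sum-const n 0) (*-zeroʳ n))
sum-indicator (suc n) (suc l) = sum-indicator n l

affine-const : ∀ {N} c → Affine {N} (λ _ → c)
affine-const {zero}  c = tt
affine-const {suc N} c = (0 , λ _ → sym (+-identityʳ c)) , affine-const c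

affine-+ : ∀ {N} {g h : Vec Bool N → ℕ} → Affine g → Affine h → Affine (λ y → g y + h y)
affine-+ {zero} _ _ = tt
affine-+ {suc N} {g} {h} ((v , gv) , g₀) ((w , hw) , h₀) =
  (v + w , λ y → trans (cong₂ _+_ (gv y) (hw y)) (swap (g (false ∷ y)) v (h (false ∷ y)) w)) , affine-+ g₀ h₀
  where
  swap : ∀ a b c d → a + b + (c + d) ≡ a + c + (b + d)
  swap = solve-∀

affine-* : ∀ {N} c {g : Vec Bool N → ℕ} → Affine g → Affine (λ y → c * g y)
affine-* {zero} c _ = tt
affine-* {suc N} c {g} ((w , gw) , g₀) =
  (c * w , λ y → trans (cong (c *_) (gw y)) (*-distribˡ-+ c (g (false ∷ y)) w)) , affine-* c g₀

affine-sum : ∀ {N m} {g : Fin m → Vec Bool N → ℕ} → (∀ i → Affine (g i)) → Affine (λ y → ∑[ i < m ] g i y)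
affine-sum {m = zero}  _  = affine-const 0
affine-sum {m = suc m} ag = affine-+ (ag zero) (affine-sum (ag ∘ suc))

affine-at : ∀ {N} l → Affine {N} (λ y → bit (at y l))
affine-at {zero}  l       = tt
affine-at {suc N} zero    = (1 , λ _ → refl) , affine-const 0
affine-at {suc N} (suc l) = (0 , λ y → sym (+-identityʳ _)) , affine-at l

affine-after-ones : ∀ i {N} l → Affine {N} (λ y → bit (after-ones i (true ∷ y) l))
affine-after-ones zero    zero    = affine-const 1
affine-after-ones zero    (suc l) = affine-at l
affine-after-ones (suc i) zero    = affine-const 1
affine-after-ones (suc i) (suc l) = affine-after-ones i l

value : ∀ {k A} → Gate k A → (A → Bool) → ℕ
value g v = ∑[ l < fanIn ] (weight l * bit (v (input l)))
  where open Gate g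

evalGate-cong : ∀ {k A} (g : Gate k A) (v w : A → Bool) →
                (∀ l → v (Gate.input g l) ≡ w (Gate.input g l)) → evalGate g v ≡ evalGate g w
evalGate-cong g v w v≗w =
  cong (λ s → does (threshold ℤ.≤? + s)) (sum-cong-≗ λ l → cong (λ b → weight l * bit b) (v≗w l))
  where open Gate g

value≤ : ∀ {k A} (g : Gate k A) v → value g v ≤ k
value≤ g v = ≤-trans (sum-mono-≤ λ l → subst (weight l * bit (v (input l)) ≤_) (*-identityʳ (weight l))
                                             (*-monoʳ-≤ (weight l) (bit≤1 (v (input l))))) bounded
  where open Gate g

value-+ : ∀ {k A} (g : Gate k A) (u v w : A → Bool) → (∀ a → bit (u a) ≡ bit (v a) + bit (w a)) →
          value g u ≡ value g v + value g w
value-+ g u v w eq = trans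
  (sum-cong-≗ λ l → trans (cong (weight l *_) (eq (input l))) (*-distribˡ-+ (weight l) (bit (v (input l))) _))
  (∑-distrib-+ (λ l → weight l * bit (v (input l))) (λ l → weight l * bit (w (input l))))
  where open Gate g

-- Every wire weighs at least 1. For the top gate this bounds the number of bottom gates.
fanIn≤ : ∀ {k A} (g : Gate k A) → Gate.fanIn g ≤ k
fanIn≤ g = ≤-trans (≤-reflexive (sym (trans (sum-const fanIn 1) (*-identityʳ fanIn))))
                   (≤-trans (sum-mono-≤ positive) bounded)
  where open Gate g

evalGate-mono : ∀ {k A} (g : Gate k A) v w → value g v ≤ value g w → bit (evalGate g v) ≤ bit (evalGate g w)
evalGate-mono g v w v≤w with Gate.threshold g ℤ.≤? + value g v | Gate.threshold g ℤ.≤? + value g w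
... | yes t≤v | yes _   = ≤-refl
... | yes t≤v | no  t≰w = contradiction (ℤ.≤-trans t≤v (ℤ.+≤+ v≤w)) t≰w
... | no  _   | _       = z≤n

-- Evaluating at the i-th unit vector adds up all wires that carry variable i.
weightOf : ∀ {k n} → Gate k (Fin n) → ℕ → ℕ
weightOf g i = value g (λ l → toℕ l ≡ᵇ i)

-- Each wire carries exactly one variable, so exchanging the sums counts its weight once.
sum-weightOf≤ : ∀ {k n} (g : Gate k (Fin n)) → ∑[ i < n ] weightOf g (toℕ i) ≤ k
sum-weightOf≤ {k} {n} g = begin
  ∑[ i < n ] ∑[ l < fanIn ] (weight l * bit (toℕ (input l) ≡ᵇ toℕ i))
    ≡⟨ ∑-comm {n} {fanIn} (λ i l → weight l * bit (toℕ (input l) ≡ᵇ toℕ i)) ⟩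
  ∑[ l < fanIn ] ∑[ i < n ] (weight l * bit (toℕ (input l) ≡ᵇ toℕ i))
    ≡⟨ sum-cong-≗ (λ l → trans (sym (*-distribˡ-sum {n} (weight l) (λ i → bit (toℕ (input l) ≡ᵇ toℕ i))))
         (trans (cong (weight l *_) (sum-indicator n (input l))) (*-identityʳ (weight l)))) ⟩
  sum weight
    ≤⟨ bounded ⟩
  k ∎
  where
  open Gate g
  open ≤-Reasoning

-- Gates along the chain A_0, ..., A_n.

chain : ∀ {n} → ℕ → Fin n → Bool
chain i l = toℕ l <ᵇ i

value-chain : ∀ {k n} (g : Gate k (Fin n)) i → value g (chain (suc i)) ≡ value g (chain i) + weightOf g i
value-chain g i = value-+ g (chain (suc i)) (chain i) (λ l → toℕ l ≡ᵇ i) (λ l → bit-chain i (toℕ l))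

-- Gates are monotone along the chain, so truncation loses nothing: the value is 1 exactly when g
-- switches on between A_i and A_(i+1).
flips : ∀ {k n} → Gate k (Fin n) → ℕ → ℕ
flips g i = bit (evalGate g (chain (suc i))) ∸ bit (evalGate g (chain i))

telescope : ∀ n (h : ℕ → ℕ) → (∀ i → h i ≤ h (suc i)) →
            h 0 + ∑[ i < n ] (h (suc (toℕ i)) ∸ h (toℕ i)) ≡ h n
telescope zero    h mono = +-identityʳ (h 0)
telescope (suc n) h mono = begin
  h 0 + (h 1 ∸ h 0 + S)  ≡⟨ +-assoc (h 0) _ S ⟨
  h 0 + (h 1 ∸ h 0) + S  ≡⟨ cong (_+ S) (m+[n∸m]≡n (mono 0)) ⟩
  h 1 + S                ≡⟨ telescope n (h ∘ suc) (mono ∘ suc) ⟩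
  h (suc n)              ∎
  where
  open ≡-Reasoning
  S : ℕ
  S = ∑[ i < n ] (h (suc (suc (toℕ i))) ∸ h (suc (toℕ i)))

sum-flips≤1 : ∀ {k n} (g : Gate k (Fin n)) → ∑[ i < n ] flips g (toℕ i) ≤ 1
sum-flips≤1 {n = n} g = begin
  ∑[ i < n ] flips g (toℕ i)        ≤⟨ m≤n+m _ (h 0) ⟩
  h 0 + ∑[ i < n ] flips g (toℕ i)  ≡⟨ telescope n h (λ i → evalGate-mono g (chain i) (chain (suc i))
                                          (subst (value g (chain i) ≤_) (sym (value-chain g i)) (m≤m+n _ _))) ⟩
  h n                               ≤⟨ bit≤1 (evalGate g (chain n)) ⟩
  1                                 ∎
  where
  open ≤-Reasoning
  h : ℕ → ℕ
  h i = bit (evalGate g (chain i))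

-- With thresholds confined to [0, k + 1], the factors of F(0) have absolute value
-- at most k.
clamp : ∀ (t : ℤ) k → ∃[ τ ] (τ ≤ suc k × (∀ {V} → V ≤ k → does (t ℤ.≤? + V) ≡ does (τ ≤? V)))
clamp -[1+ t ] k = 0 , z≤n , λ _ → refl
clamp (+ t)    k with t ≤? suc k
... | yes t≤1+k = t , t≤1+k , λ _ → refl
... | no t≰1+k = suc k , ≤-refl , λ {V} V≤k → trans
  (dec-false (+ t ℤ.≤? + V) λ { (ℤ.+≤+ t≤V) → t≰1+k (≤-trans t≤V (m≤n⇒m≤1+n V≤k)) })
  (sym (dec-false (suc k ≤? V) (≤⇒≯ V≤k)))

-- The gate that switches on between A_i and A_(i+1).

MAJ-true : ∀ {n} (x : Vector Bool n) {s} → ∑[ i < n ] bit (x i) ≡ s → n ≤ 2 * s → MAJ x ≡ true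
MAJ-true x refl n≤2s = dec-true (_ ≤? _) n≤2s

MAJ-false : ∀ {n} (x : Vector Bool n) {s} → ∑[ i < n ] bit (x i) ≡ s → 2 * s < n → MAJ x ≡ false
MAJ-false x refl 2s<n = dec-false (_ ≤? _) (<⇒≱ 2s<n)


-- The last two bounds express |a - b| ≤ k, and the only multiple of p that small is 0.
small-multiple : ∀ {p k a b} → + p ∣ + a ℤ.- + b → k < p → a ≤ k + b → b ≤ k + a → a ≡ b
small-multiple {p} {k} {a} {b} p∣a-b k<p a≤k+b b≤k+a =
  [ (λ a≤b → sym (ordered b≤k+a a≤b (subst (p ℕ.∣_) (trans (ℤ.∣m⊖n∣≡∣n⊖m∣ a b) (cong ℤ.∣_∣ (ℤ.⊖-≥ a≤b))) p∣a⊖b)))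
  , (λ b≤a → ordered a≤k+b b≤a (subst (p ℕ.∣_) (cong ℤ.∣_∣ (ℤ.⊖-≥ b≤a)) p∣a⊖b)) ]′ (≤-total a b)
  where
  p∣a⊖b : p ℕ.∣ ℤ.∣ a ℤ.⊖ b ∣
  p∣a⊖b = subst (λ z → p ℕ.∣ ℤ.∣ z ∣) (ℤ.m-n≡m⊖n a b) (∣⇒∣ᵤ p∣a-b)
  ordered : ∀ {a b} → a ≤ k + b → b ≤ a → p ℕ.∣ a ∸ b → a ≡ b
  ordered {a} {b} a≤k+b b≤a p∣a∸b with a ∸ b in eq
  ... | zero  = ≤-antisym (m∸n≡0⇒m≤n eq) b≤a
  ... | suc d = contradiction (ℕ.∣⇒≤ p∣a∸b)
    (<⇒≱ (≤-<-trans (subst (_≤ k) eq (m≤n+o⇒m∸n≤o a b (subst (a ≤_) (+-comm k b) a≤k+b))) k<p))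

-- By `above` and `below`, i + 1 + p ones form a majority and i + p do not, so variable i decides
-- whenever y has p ones and k zeros.
module _ {k n} (C : MAJ∘MAJ k n) (computes : Computes-MAJ C)
         {p} (pr : Prime p) (k<p : k < p)
         (i : ℕ) (fits : i + suc (p + k) ≤ n)
         (above : n ≤ 2 * (i + suc p)) (below : 2 * (i + p) < n)
         (light : ∑[ j < Gate.fanIn C ] weightOf (Gate.input C j) i ≤ k) where

  private
    m = Gate.fanIn C

    gate : Fin m → Gate k (Fin n)
    gate = Gate.input C

    point : Bool → Vec Bool (p + k) → Fin n → Bool
    point b y = after-ones i (b ∷ y) ∘ toℕ

    w τ : Fin m → ℕ
    w j = weightOf (gate j) i
    τ j = proj₁ (clamp (Gate.threshold (gate j)) k)

    V : Bool → Fin m → Vec Bool (p + k) → ℕ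
    V b j y = value (gate j) (point b y)

    V-true : ∀ j y → V true j y ≡ V false j y + w j
    V-true j y = value-+ (gate j) (point true y) (point false y) (λ l → toℕ l ≡ᵇ i) (λ l → bit-after-ones i y (toℕ l))

    evalGate≡ : ∀ b j y → evalGate (gate j) (point b y) ≡ does (τ j ≤? V b j y)
    evalGate≡ b j y = proj₂ (proj₂ (clamp (Gate.threshold (gate j)) k)) (value≤ (gate j) (point b y))

    -- Since `V true` is `V false` plus w, some factor of gate j vanishes exactly when `V false` < τ
    -- ≤ `V true`, that is, when variable i switches the gate.
    factor : (j : Fin m) → Fin (w j) → BoolFun (p + k)
    factor j s y = + V true j y ℤ.- + (τ j + toℕ s)

    F : BoolFun (p + k)
    F y = ∏ (λ j → ∏ (λ s → factor j s y))

    V-affine : ∀ j → Affine (V true j)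
    V-affine j = affine-sum λ l → affine-* (Gate.weight (gate j) l) (affine-after-ones i (toℕ (Gate.input (gate j) l)))

    -- The constant 1 is multiplied by ∑ w ≤ k affine factors, each raising the degree by at most 1.
    F-deg : Deg< (p + k) (suc k) F
    F-deg = Deg<-mono (≤-trans (≤-reflexive (+-comm (sum w) 1)) (s≤s light))
      (Deg<-cong (sum w + 1) (λ y → ℤ.*-identityˡ (F y))
        (∏-raises w (λ j y → ∏ (λ s → factor j s y))
          (λ j → subst (λ e → Raises e (λ y → ∏ (λ s → factor j s y))) (trans (sum-const (w j) 1) (*-identityʳ (w j)))
            (∏-raises (λ _ → 1) (factor j) λ s → affine-raises (V-affine j) (τ j + toℕ s)))
          1 (Deg<-const (p + k) 1ℤ)))

    weight-point : ∀ b y → zeros y ≡ k → ∑[ l < n ] bit (point b y l) ≡ i + (bit b + p)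
    weight-point b y zeros≡k = trans (sum-at (replicate i true ++ b ∷ y) fits)
      (trans (ones-replicate-++ i (b ∷ y)) (cong (λ o → i + (bit b + o))
        (+-cancelʳ-≡ k (ones y) p (trans (cong (λ z → ones y + z) (sym zeros≡k)) (ones+zeros y)))))

    switching-gate : ∀ y → zeros y ≡ k →
      ∃[ j ] evalGate (gate j) (point true y) ≢ evalGate (gate j) (point false y)
    switching-gate y zeros≡k = ¬∀⟶∃¬ m _ (λ j → _ Bool.≟ _) λ same → contradiction
      (trans (sym (MAJ-true (point true y) (weight-point true y zeros≡k) above))
        (trans (sym (computes (point true y)))
          (trans (evalGate-cong C (λ g → evalGate g (point true y)) (λ g → evalGate g (point false y)) same)
            (trans (computes (point false y))
              (MAJ-false (point false y) (weight-point false y zeros≡k) below)))))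
      λ ()

    F-vanishes : ∀ y → zeros y ≡ k → F y ≡ 0ℤ
    F-vanishes y zeros≡k with j , differ ← switching-gate y zeros≡k =
      ∏≡0 (λ j → ∏ (λ s → factor j s y)) j (vanish (τ j ≤? V true j y) (τ j ≤? V false j y) differ′)
      where
      differ′ : does (τ j ≤? V true j y) ≢ does (τ j ≤? V false j y)
      differ′ eq = differ (trans (evalGate≡ true j y) (trans eq (sym (evalGate≡ false j y))))
      vanish : (a : Dec (τ j ≤ V true j y)) (b : Dec (τ j ≤ V false j y)) → does a ≢ does b →
               ∏ (λ s → factor j s y) ≡ 0ℤ
      vanish (yes _)   (yes _)  ne = contradiction refl ne
      vanish (no _)    (no _)   ne = contradiction refl ne
      vanish (no τ≰V)  (yes τ≤) _  = contradiction (≤-trans τ≤ (subst (V false j y ≤_) (sym (V-true j y)) (m≤m+n _ _))) τ≰V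
      -- The vanishing factor has s = `V true` - τ, which is below w because `V false` < τ.
      vanish (yes τ≤V) (no τ≰)  _  = ∏≡0 (λ s → factor j s y) (fromℕ< s<w)
        (trans (cong (λ u → + V true j y ℤ.- + u)
                     (trans (cong (λ s → τ j + s) (toℕ-fromℕ< s<w)) (m+[n∸m]≡n τ≤V)))
               (ℤ.+-inverseʳ (+ V true j y)))
        where
        s<w : V true j y ∸ τ j < w j
        s<w = +-cancelˡ-< (τ j) _ _ (subst (_< τ j + w j) (sym (m+[n∸m]≡n τ≤V))
                (subst (_< τ j + w j) (sym (V-true j y)) (+-monoˡ-< (w j) (≰⇒> τ≰))))

    o = origin (p + k)

    -- At y = 0 the two points are A_(i+1) and A_i. A factor divisible by p is 0 there, which puts τ
    -- above `V false` and at most at `V true`.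
    critical⇒flips : ∀ j s → + p ∣ factor j s o → flips (gate j) i ≡ 1
    critical⇒flips j s p∣f = cong₂ (λ a b → bit a ∸ bit b) after before
      where
      open ≤-Reasoning
      V≡τ+s : V true j o ≡ τ j + toℕ s
      V≡τ+s = small-multiple p∣f k<p (≤-trans (value≤ (gate j) (point true o)) (m≤m+n k _)) (begin
        τ j + toℕ s        ≤⟨ +-monoˡ-≤ (toℕ s) (proj₁ (proj₂ (clamp (Gate.threshold (gate j)) k))) ⟩
        -- The excess 1 in the bound τ ≤ k + 1 is absorbed by s < w.
        suc k + toℕ s      ≡⟨ +-suc k (toℕ s) ⟨
        k + suc (toℕ s)    ≤⟨ +-monoʳ-≤ k (toℕ<n s) ⟩
        k + w j            ≤⟨ +-monoʳ-≤ k (subst (w j ≤_) (sym (V-true j o)) (m≤n+m _ _)) ⟩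
        k + V true j o     ∎)
      V<τ : V false j o < τ j
      V<τ = +-cancelʳ-< (w j) _ _ (begin-strict
        V false j o + w j  ≡⟨ V-true j o ⟨
        V true j o         ≡⟨ V≡τ+s ⟩
        τ j + toℕ s        <⟨ +-monoʳ-< (τ j) (toℕ<n s) ⟩
        τ j + w j          ∎)
      after : evalGate (gate j) (chain (suc i)) ≡ true
      after = trans
        (evalGate-cong (gate j) (chain (suc i)) (point true o)
          (λ l → sym (after-ones-1 i (p + k) (toℕ (Gate.input (gate j) l)))))
        (trans (evalGate≡ true j o)
          (dec-true (τ j ≤? V true j o) (subst (τ j ≤_) (sym V≡τ+s) (m≤m+n (τ j) (toℕ s)))))
      before : evalGate (gate j) (chain i) ≡ false
      before = trans
        (evalGate-cong (gate j) (chain i) (point false o)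
          (λ l → sym (after-ones-0 i (p + k) (toℕ (Gate.input (gate j) l)))))
        (trans (evalGate≡ false j o) (dec-false (τ j ≤? V false j o) (<⇒≱ V<τ)))

    critical-gate : ∃[ j ] + p ∣ ∏ (λ s → factor j s o)
    critical-gate = prime∣∏ pr (λ j → ∏ (λ s → factor j s o)) (hegedus pr k<p F-deg F-vanishes)

    critical-factor : ∀ j → + p ∣ ∏ (λ s → factor j s o) → ∃[ s ] + p ∣ factor j s o
    critical-factor j = prime∣∏ pr (λ s → factor j s o)

  flipping-gate : ∃[ j ] flips (gate j) i ≡ 1
  flipping-gate =
    let j , p∣∏ = critical-gate
        s , p∣f = critical-factor j p∣∏
    in  j , critical⇒flips j s p∣f

-- Counting

largePrimeBit : ℕ → ℕ → ℕ
largePrimeBit k m = bit (does (prime? m) ∧ does (k <? m))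

largePrimeBit-cases : ∀ k m → largePrimeBit k m ≡ 0 ⊎ (Prime m × k < m)
largePrimeBit-cases k m with prime? m | k <? m
... | no _   | _       = inj₁ refl
... | yes _  | no k≮m  = inj₁ (cong bit (dec-false (k <? m) k≮m))
... | yes pr | yes k<m = inj₂ (pr , k<m)

-- Here N + 1 is the threshold T of the majority, and index i belongs to the candidate prime p = N -
-- i.
module _ {k n} (C : MAJ∘MAJ k n) (computes : Computes-MAJ C)
         {N} (above : n ≤ 2 * suc N) (below : 2 * N < n) (fits : suc N + k ≤ n) where

  private
    m = Gate.fanIn C

    gate : Fin m → Gate k (Fin n)
    gate = Gate.input C

    -- A flip is priced at k + 1, the least total weight of a variable that is not light. Either way
    -- an index belonging to a prime above k is paid at least k + 1.
    cost : ℕ → Fin m → ℕ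
    cost i j = weightOf (gate j) i + suc k * flips (gate j) i

    cost≥ : ∀ i → suc k * largePrimeBit k (N ∸ i) ≤ sum (cost i)
    cost≥ i with largePrimeBit-cases k (N ∸ i)
    ... | inj₁ none = ≤-trans (≤-reflexive (trans (cong (suc k *_) none) (*-zeroʳ (suc k)))) z≤n
    ... | inj₂ (pr , k<p) with sum (λ j → weightOf (gate j) i) ≤? k
    ...   | no heavy = begin
      suc k * largePrimeBit k (N ∸ i)  ≤⟨ *-monoʳ-≤ (suc k) (bit≤1 _) ⟩
      suc k * 1                        ≡⟨ *-identityʳ (suc k) ⟩
      suc k                            ≤⟨ ≰⇒> heavy ⟩
      sum (λ j → weightOf (gate j) i)  ≤⟨ sum-mono-≤ (λ j → m≤m+n (weightOf (gate j) i) _) ⟩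
      sum (cost i)                     ∎
      where open ≤-Reasoning
    ...   | yes light = begin
      suc k * largePrimeBit k (N ∸ i)  ≤⟨ *-monoʳ-≤ (suc k) (bit≤1 _) ⟩
      suc k * 1                        ≡⟨ cong (suc k *_) flips≡1 ⟨
      suc k * flips (gate j) i         ≤⟨ m≤n+m _ (weightOf (gate j) i) ⟩
      cost i j                         ≤⟨ term≤sum (cost i) j ⟩
      sum (cost i)                     ∎
      where
      open ≤-Reasoning
      i+p≡N : i + (N ∸ i) ≡ N
      -- A prime above k is positive, so N ∸ i is not truncated.
      i+p≡N = m+[n∸m]≡n {i} (<⇒≤ (m∸n≢0⇒n<m (>⇒≢ (≤-<-trans z≤n k<p))))
      i+1+p≡1+N : i + suc (N ∸ i) ≡ suc N
      i+1+p≡1+N = trans (+-suc i (N ∸ i)) (cong suc i+p≡N)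
      flipping : ∃[ j ] flips (gate j) i ≡ 1
      flipping = flipping-gate C computes pr k<p i
        (subst (_≤ n) (trans (cong (λ s → s + k) (sym i+1+p≡1+N)) (+-assoc i (suc (N ∸ i)) k)) fits)
        (subst (λ t → n ≤ 2 * t) (sym i+1+p≡1+N) above)
        (subst (λ t → 2 * t < n) (sym i+p≡N) below)
        light
      j = proj₁ flipping
      flips≡1 = proj₂ flipping

    total-cost : ∀ j → ∑[ i < n ] cost (toℕ i) j ≤ k + suc k
    total-cost j = begin
      ∑[ i < n ] (W i + suc k * f i)             ≡⟨ ∑-distrib-+ W (λ i → suc k * f i) ⟩
      sum W + ∑[ i < n ] (suc k * f i)           ≡⟨ cong (λ s → sum W + s) (*-distribˡ-sum (suc k) f) ⟨
      sum W + suc k * sum f                      ≤⟨ +-mono-≤ (sum-weightOf≤ (gate j))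
                                                      (*-monoʳ-≤ (suc k) (sum-flips≤1 (gate j))) ⟩
      k + suc k * 1                              ≡⟨ cong (λ s → k + s) (*-identityʳ (suc k)) ⟩
      k + suc k                                  ∎
      where
      open ≤-Reasoning
      W f : Fin n → ℕ
      W i = weightOf (gate j) (toℕ i)
      f i = flips (gate j) (toℕ i)

  -- Each of at most k gates pays at most k for weights and k + 1 for its single flip, and k (2k +
  -- 1) < (k + 1)(2k + 1).
  large-primes≤2k : ∑[ i < n ] largePrimeBit k (N ∸ toℕ i) ≤ 2 * k
  large-primes≤2k = ≤-pred (*-cancelˡ-< (suc k) Q (suc (2 * k)) (begin-strict
    suc k * Q                                               ≡⟨ *-distribˡ-sum {n} (suc k) (λ i → largePrimeBit k (N ∸ toℕ i)) ⟩
    ∑[ i < n ] (suc k * largePrimeBit k (N ∸ toℕ i))        ≤⟨ sum-mono-≤ {n} (λ i → cost≥ (toℕ i)) ⟩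
    ∑[ i < n ] ∑[ j < m ] cost (toℕ i) j                    ≡⟨ ∑-comm {n} {m} (λ i j → cost (toℕ i) j) ⟩
    ∑[ j < m ] ∑[ i < n ] cost (toℕ i) j                    ≤⟨ sum-mono-≤ total-cost ⟩
    ∑[ j < m ] (k + suc k)                                  ≡⟨ sum-const m (k + suc k) ⟩
    m * (k + suc k)                                         ≤⟨ *-monoˡ-≤ (k + suc k) (fanIn≤ C) ⟩
    k * (k + suc k)                                         <⟨ m<m+n (k * (k + suc k)) z<s ⟩
    k * (k + suc k) + suc (2 * k)                           ≡⟨ regroup k ⟩
    suc k * suc (2 * k)                                     ∎))
    where
    open ≤-Reasoning
    Q : ℕ
    Q = ∑[ i < n ] largePrimeBit k (N ∸ toℕ i)
    regroup : ∀ k → k * (k + suc k) + suc (2 * k) ≡ suc k * suc (2 * k)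
    regroup = solve-∀

-- The first N indices run through N, ..., 1; the remaining ones only add copies of g 0.
∑from≤∑-reversed : ∀ g N {n} → N ≤ n → ∑from g 1 N ≤ ∑[ i < n ] g (N ∸ toℕ i)
∑from≤∑-reversed g zero    _         = z≤n
∑from≤∑-reversed g (suc N) {suc n} (s≤s N≤n) = begin
  ∑from g 1 (suc N)                          ≡⟨ ∑from-snoc g 1 N ⟩
  ∑from g 1 N + g (suc N)                    ≡⟨ +-comm (∑from g 1 N) (g (suc N)) ⟩
  g (suc N) + ∑from g 1 N                    ≤⟨ +-monoʳ-≤ (g (suc N)) (∑from≤∑-reversed g N N≤n) ⟩
  g (suc N) + ∑[ i < n ] g (N ∸ toℕ i)       ∎
  where open ≤-Reasoning

π≤ : ∀ N → π N ≤ N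
π≤ zero    = z≤n
π≤ (suc N) = begin
  π (suc N)                    ≡⟨ ∑from-snoc primeBit 1 N ⟩
  π N + primeBit (suc N)       ≤⟨ +-mono-≤ (π≤ N) (bit≤1 (does (prime? (suc N)))) ⟩
  N + 1                        ≡⟨ +-comm N 1 ⟩
  suc N                        ∎
  where open ≤-Reasoning

-- Up to k the trivial bound on `π` suffices; beyond k both counts grow together.
π≤k+large : ∀ k N → π N ≤ k + ∑from (largePrimeBit k) 1 N
π≤k+large k zero    = z≤n
π≤k+large k (suc N) with k <? suc N in large
... | no k≮1+N = ≤-trans (π≤ (suc N)) (≤-trans (≮⇒≥ k≮1+N) (m≤m+n k _))
... | yes k<1+N = begin
  π (suc N)                                               ≡⟨ ∑from-snoc primeBit 1 N ⟩
  π N + primeBit (suc N)                                  ≤⟨ +-mono-≤ (π≤k+large k N) (≤-reflexive same) ⟩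
  k + ∑from (largePrimeBit k) 1 N + largePrimeBit k (suc N) ≡⟨ +-assoc k _ _ ⟩
  k + (∑from (largePrimeBit k) 1 N + largePrimeBit k (suc N)) ≡⟨ cong (λ s → k + s) (∑from-snoc (largePrimeBit k) 1 N) ⟨
  k + ∑from (largePrimeBit k) 1 (suc N)                   ∎
  where
  open ≤-Reasoning
  same : primeBit (suc N) ≡ largePrimeBit k (suc N)
  same = cong bit (trans (sym (Bool.∧-identityʳ (does (prime? (suc N)))))
                         (cong (does (prime? (suc N)) ∧_) (sym (dec-true (k <? suc N) k<1+N))))

-- From the count of primes to a bound on n.

log₂-ceil : ∀ N → 1 ≤ N → ∃[ e ] (1 ≤ e × N ≤ 2 ^ e × 2 ^ e ≤ 2 * N)
-- The exponent is 1 rather than 0, since later estimates divide by powers of 2 no further than e ≥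
-- 1.
log₂-ceil 1 _ = 1 , ≤-refl , s≤s z≤n , ≤-refl
log₂-ceil (suc N@(suc _)) _ with e , 1≤e , N≤2^e , 2^e≤2N ← log₂-ceil N z<s | suc N ≤? 2 ^ e
... | yes 1+N≤2^e = e , 1≤e , 1+N≤2^e , ≤-trans 2^e≤2N (*-monoʳ-≤ 2 (n≤1+n N))
... | no  1+N≰2^e = suc e , z<s ,
  ≤-trans (+-mono-≤ (m^n>0 2 e) N≤2^e) (≤-reflexive (cong (λ z → 2 ^ e + z) (sym (+-identityʳ (2 ^ e))))) ,
  *-monoʳ-≤ 2 (<⇒≤ (≰⇒> 1+N≰2^e))

^-distribʳ-* : ∀ a b o → (a * b) ^ o ≡ a ^ o * b ^ o
^-distribʳ-* a b zero    = refl
^-distribʳ-* a b (suc o) = trans (cong (a * b *_) (^-distribʳ-* a b o)) (swap a b (a ^ o) (b ^ o))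
  where
  swap : ∀ w x y z → w * x * (y * z) ≡ w * y * (x * z)
  swap = solve-∀

-- With q = ⌊e / 4⌋, e ≤ 4 (q + 1) ≤ 4 · 2^q; take fourth powers.
e^4≤4^4*2^e : ∀ e → e ^ 4 ≤ 4 ^ 4 * 2 ^ e
e^4≤4^4*2^e e = begin
  e ^ 4                    ≤⟨ ^-monoˡ-≤ 4 e≤4*2^q ⟩
  (4 * 2 ^ q) ^ 4          ≡⟨ ^-distribʳ-* 4 (2 ^ q) 4 ⟩
  4 ^ 4 * (2 ^ q) ^ 4      ≡⟨ cong (4 ^ 4 *_) (^-*-assoc 2 q 4) ⟩
  4 ^ 4 * 2 ^ (q * 4)      ≤⟨ *-monoʳ-≤ (4 ^ 4) (^-monoʳ-≤ 2 (m/n*n≤m e 4)) ⟩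
  4 ^ 4 * 2 ^ e            ∎
  where
  open ≤-Reasoning
  q : ℕ
  q = e / 4
  e≤4*2^q : e ≤ 4 * 2 ^ q
  e≤4*2^q = begin
    e                    ≡⟨ m≡m%n+[m/n]*n e 4 ⟩
    e % 4 + q * 4        ≤⟨ +-monoˡ-≤ (q * 4) (<⇒≤ (m%n<n e 4)) ⟩
    suc q * 4            ≤⟨ *-monoˡ-≤ 4 (n<m^n ≤-refl q) ⟩
    2 ^ q * 4            ≡⟨ *-comm (2 ^ q) 4 ⟩
    4 * 2 ^ q            ∎

-- Both sides of n ≤ 16 k e are raised to the 19th power, and e¹⁹ ≤ (e⁴)⁵ is
-- absorbed into n⁶.
poly-from-log : ∀ {n k e} → 1 ≤ n → 1 ≤ e → n ≤ 16 * k * e → e ^ 4 ≤ 8 ^ 3 * n → n ^ 13 ≤ (128 * k) ^ 19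
poly-from-log {n} {k} {e} 1≤n 1≤e n≤16ke e^4≤ = *-cancelʳ-≤ (n ^ 13) _ (n ^ 6) {{m^n≢0 n 6}} (begin
  n ^ 13 * n ^ 6                  ≡⟨ ^-distribˡ-+-* n 13 6 ⟨
  n ^ 19                          ≤⟨ ^-monoˡ-≤ 19 n≤16ke ⟩
  (16 * k * e) ^ 19               ≡⟨ ^-distribʳ-* (16 * k) e 19 ⟩
  (16 * k) ^ 19 * e ^ 19          ≤⟨ *-monoʳ-≤ ((16 * k) ^ 19) e^19≤ ⟩
  (16 * k) ^ 19 * (8 ^ 19 * n ^ 6) ≡⟨ *-assoc ((16 * k) ^ 19) (8 ^ 19) (n ^ 6) ⟨
  (16 * k) ^ 19 * 8 ^ 19 * n ^ 6  ≡⟨ cong (_* n ^ 6) (^-distribʳ-* (16 * k) 8 19) ⟨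
  (16 * k * 8) ^ 19 * n ^ 6       ≡⟨ cong (λ z → z ^ 19 * n ^ 6) (trans (*-comm (16 * k) 8) (sym (*-assoc 8 16 k))) ⟩
  (128 * k) ^ 19 * n ^ 6          ∎)
  where
  open ≤-Reasoning
  instance
    _ = >-nonZero 1≤n
    _ = >-nonZero 1≤e
  e^19≤ : e ^ 19 ≤ 8 ^ 19 * n ^ 6
  e^19≤ = begin
    e ^ 19               ≤⟨ ^-monoʳ-≤ e (n≤1+n 19) ⟩
    e ^ 20               ≡⟨ ^-*-assoc e 4 5 ⟨
    (e ^ 4) ^ 5          ≤⟨ ^-monoˡ-≤ 5 e^4≤ ⟩
    (8 ^ 3 * n) ^ 5      ≡⟨ ^-distribʳ-* (8 ^ 3) n 5 ⟩
    (8 ^ 3) ^ 5 * n ^ 5  ≡⟨ cong (_* n ^ 5) (^-*-assoc 8 3 5) ⟩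
    8 ^ 15 * n ^ 5       ≤⟨ *-mono-≤ (^-monoʳ-≤ 8 (m≤m+n 15 4)) (^-monoʳ-≤ n (n≤1+n 5)) ⟩
    8 ^ 19 * n ^ 6       ∎

-- The cases T = 1 and T + k > n both force n ≤ 2k, where the bound is immediate. Otherwise the
-- count of primes applies with N = T - 1.
size-bound : ∀ {k n} (C : MAJ∘MAJ k n) → Computes-MAJ C → 2 ≤ n → 1 ≤ k → n ^ 13 ≤ (128 * k) ^ 19
size-bound {k} {n} C computes 2≤n 1≤k = go
  where
  open ≤-Reasoning
  instance
    _ = >-nonZero (≤-trans (n≤1+n 1) 2≤n)
    _ = >-nonZero 1≤k
  trivial : n ≤ 2 * k → n ^ 13 ≤ (128 * k) ^ 19
  trivial n≤2k = ≤-trans (^-monoʳ-≤ n (m≤m+n 13 6)) (^-monoˡ-≤ 19 (≤-trans n≤2k (*-monoˡ-≤ k (m≤m+n 2 126))))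

  half : ∀ n → 1 ≤ n → ∃[ N ] (n ≤ 2 * suc N × 2 * N < n)
  half 1 _ = 0 , s≤s z≤n , z<s
  half 2 _ = 0 , ≤-refl , z<s
  half (suc (suc n@(suc _))) _ with N , above , below ← half n z<s =
    suc N , subst (2 + n ≤_) (sym (*-suc 2 (suc N))) (+-monoʳ-≤ 2 above) ,
            subst (_< 2 + n) (sym (*-suc 2 N)) (+-monoʳ-< 2 below)

  main : ∀ M → n ≤ 2 * suc (suc M) → 2 * suc M < n → suc (suc M) + k ≤ n → n ^ 13 ≤ (128 * k) ^ 19
  main M above below fits with e , 1≤e , N≤2^e , 2^e≤2N ← log₂-ceil (suc M) z<s =
    poly-from-log {n} {k} {e} (≤-trans (n≤1+n 1) 2≤n) 1≤e n≤16ke (begin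
      e ^ 4                  ≤⟨ e^4≤4^4*2^e e ⟩
      4 ^ 4 * 2 ^ e          ≤⟨ *-monoʳ-≤ (4 ^ 4) (≤-trans 2^e≤2N (<⇒≤ below)) ⟩
      4 ^ 4 * n              ≤⟨ *-monoˡ-≤ n (m≤m+n (4 ^ 4) 256) ⟩
      8 ^ 3 * n              ∎)
    where
    N : ℕ
    N = suc M
    N≤n : N ≤ n
    N≤n = ≤-trans (n≤1+n N) (≤-trans (m≤m+n (suc N) k) fits)
    π≤3k : π N ≤ 3 * k
    π≤3k = begin
      π N                                             ≤⟨ π≤k+large k N ⟩
      k + ∑from (largePrimeBit k) 1 N                 ≤⟨ +-monoʳ-≤ k (∑from≤∑-reversed (largePrimeBit k) N N≤n) ⟩
      k + ∑[ i < n ] largePrimeBit k (N ∸ toℕ i)      ≤⟨ +-monoʳ-≤ k (large-primes≤2k C computes above below fits) ⟩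
      k + 2 * k                                       ∎
    M≤3ke : M ≤ e * (3 * k)
    -- Chebyshev's bound and `π N` ≤ 3k are compared through their exponents of 2.
    M≤3ke = ≮⇒≥ λ e3k<M → <⇒≱ (^-monoʳ-< 2 ≤-refl e3k<M) (begin
      2 ^ M                ≤⟨ chebyshev M ⟩
      N ^ π N              ≤⟨ ^-monoʳ-≤ N π≤3k ⟩
      N ^ (3 * k)          ≤⟨ ^-monoˡ-≤ (3 * k) N≤2^e ⟩
      (2 ^ e) ^ (3 * k)    ≡⟨ ^-*-assoc 2 e (3 * k) ⟩
      2 ^ (e * (3 * k))    ∎)
    n≤16ke : n ≤ 16 * k * e
    n≤16ke = begin
      n                          ≤⟨ above ⟩
      2 * (2 + M)                ≤⟨ *-monoʳ-≤ 2 (+-mono-≤ (*-monoʳ-≤ 2 (*-mono-≤ 1≤k 1≤e)) M≤3ke) ⟩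
      -- The estimate 10 k e is rounded up to the form that `poly-from-log` expects.
      2 * (2 * (k * e) + e * (3 * k)) ≤⟨ m≤m+n _ (6 * (k * e)) ⟩
      2 * (2 * (k * e) + e * (3 * k)) + 6 * (k * e) ≡⟨ regroup k e ⟩
      16 * k * e                 ∎
      where
      regroup : ∀ k e → 2 * (2 * (k * e) + e * (3 * k)) + 6 * (k * e) ≡ 16 * k * e
      regroup = solve-∀

  go : n ^ 13 ≤ (128 * k) ^ 19
  go with half n (≤-trans (n≤1+n 1) 2≤n)
  ... | zero  , above , below = trivial (≤-trans above (*-monoʳ-≤ 2 1≤k))
  ... | suc M , above , below with suc (suc M) + k ≤? n
  ...   | yes fits = main M above below fits
  ...   | no  wide = trivial (+-cancelˡ-≤ n n (2 * k) (begin
    n + n                          ≡⟨ cong (λ z → n + z) (+-identityʳ n) ⟨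
    2 * n                          ≤⟨ *-monoʳ-≤ 2 (≤-pred (≰⇒> wide)) ⟩
    2 * (suc M + k)                ≡⟨ *-distribˡ-+ 2 (suc M) k ⟩
    2 * suc M + 2 * k              ≤⟨ +-monoˡ-≤ (2 * k) (<⇒≤ below) ⟩
    n + 2 * k                      ∎))

-- Passage to the rationals.

/-mono-≤ : ∀ a q b r .{{_ : NonZero q}} .{{_ : NonZero r}} → a * r ≤ b * q → + a ℚ./ q ℚ.≤ + b ℚ./ r
/-mono-≤ a q@(suc q-1) b r@(suc r-1) ar≤bq = ℚ.toℚᵘ-cancel-≤
  (ℚᵘ.≤-respˡ-≃ (ℚᵘ.≃-sym (ℚ.toℚᵘ-fromℚᵘ (ℚᵘ.mkℚᵘ (+ a) q-1)))
    (ℚᵘ.≤-respʳ-≃ (ℚᵘ.≃-sym (ℚ.toℚᵘ-fromℚᵘ (ℚᵘ.mkℚᵘ (+ b) r-1)))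
      (ℚᵘ.*≤* (subst₂ ℤ._≤_ (ℤ.pos-* a r) (ℤ.pos-* b q) (ℤ.+≤+ ar≤bq)))))

ℕ→ℚ-mono : ∀ {a b} → a ≤ b → ℕ→ℚ a ℚ.≤ ℕ→ℚ b
ℕ→ℚ-mono {a} {b} a≤b = /-mono-≤ a 1 b 1 (*-monoˡ-≤ 1 a≤b)

ℕ→ℚ-* : ∀ a b → ℕ→ℚ (a * b) ≡ ℕ→ℚ a ℚ.* ℕ→ℚ b
ℕ→ℚ-* a b = ℚ.toℚᵘ-injective (begin
  ℚ.toℚᵘ (ℕ→ℚ (a * b))                        ≈⟨ ℚ.toℚᵘ-fromℚᵘ (ℚᵘ.mkℚᵘ (+ (a * b)) 0) ⟩
  ℚᵘ.mkℚᵘ (+ (a * b)) 0                       ≈⟨ ℚᵘ.*≡* (cong (ℤ._* + 1) (ℤ.pos-* a b)) ⟩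
  ℚᵘ.mkℚᵘ (+ a) 0 ℚᵘ.* ℚᵘ.mkℚᵘ (+ b) 0        ≈⟨ ℚᵘ.*-cong (ℚ.toℚᵘ-fromℚᵘ (ℚᵘ.mkℚᵘ (+ a) 0)) (ℚ.toℚᵘ-fromℚᵘ (ℚᵘ.mkℚᵘ (+ b) 0)) ⟨
  ℚ.toℚᵘ (ℕ→ℚ a) ℚᵘ.* ℚ.toℚᵘ (ℕ→ℚ b)          ≈⟨ ℚ.toℚᵘ-homo-* (ℕ→ℚ a) (ℕ→ℚ b) ⟨
  ℚ.toℚᵘ (ℕ→ℚ a ℚ.* ℕ→ℚ b)                    ∎)
  where open ℚᵘ.≃-Reasoning

ℕ→ℚ-^ : ∀ a m → ℕ→ℚ (a ^ m) ≡ ℕ→ℚ a ^ℚ m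
ℕ→ℚ-^ a zero    = refl
ℕ→ℚ-^ a (suc m) = trans (ℕ→ℚ-* a (a ^ m)) (cong (ℕ→ℚ a ℚ.*_) (ℕ→ℚ-^ a m))

-- The reciprocal of the constant in `size-bound`.
c : ℚ
c = + 1 ℚ./ 128

c^19*128k^19≡k^19 : ∀ k → (c ^ℚ 19) ℚ.* ℕ→ℚ ((128 * k) ^ 19) ≡ ℕ→ℚ (k ^ 19)
c^19*128k^19≡k^19 k = begin
  (c ^ℚ 19) ℚ.* ℕ→ℚ ((128 * k) ^ 19)       ≡⟨ cong ((c ^ℚ 19) ℚ.*_) (ℕ→ℚ-^ (128 * k) 19) ⟩
  (c ^ℚ 19) ℚ.* (ℕ→ℚ (128 * k) ^ℚ 19)      ≡⟨ ^ℚ-distrib-* c (ℕ→ℚ (128 * k)) 19 ⟨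
  (c ℚ.* ℕ→ℚ (128 * k)) ^ℚ 19              ≡⟨ cong (_^ℚ 19) cancel ⟩
  ℕ→ℚ k ^ℚ 19                              ≡⟨ ℕ→ℚ-^ k 19 ⟨
  ℕ→ℚ (k ^ 19)                             ∎
  where
  open ≡-Reasoning
  cancel : c ℚ.* ℕ→ℚ (128 * k) ≡ ℕ→ℚ k
  cancel = begin
    c ℚ.* ℕ→ℚ (128 * k)            ≡⟨ cong (c ℚ.*_) (ℕ→ℚ-* 128 k) ⟩
    c ℚ.* (ℕ→ℚ 128 ℚ.* ℕ→ℚ k)      ≡⟨ ℚ.*-assoc c (ℕ→ℚ 128) (ℕ→ℚ k) ⟨
    1ℚ ℚ.* ℕ→ℚ k                   ≡⟨ ℚ.*-identityˡ (ℕ→ℚ k) ⟩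
    ℕ→ℚ k                          ∎

nonNeg-c^ : ∀ m → ℚ.NonNegative (c ^ℚ m)
nonNeg-c^ zero    = _
nonNeg-c^ (suc m) = ℚ.nonNeg*nonNeg⇒nonNeg c (c ^ℚ m) {{nonNeg-c^ m}}

-- From 2^q ≤ n^q ≤ 2^p. Hence the factor (p / q)² in `LowerBound` is at least 1.
1≤log₂ : ∀ {n p q} → 2 ≤ n → log₂ n ≤ p ÷ q → q ≤ p
1≤log₂ {n} {p} {q} 2≤n n^q≤2^p = ≮⇒≥ λ p<q →
  <⇒≱ (^-monoʳ-< 2 ≤-refl p<q) (≤-trans (^-monoˡ-≤ q 2≤n) n^q≤2^p)

1≤x⇒y≤y*x² : ∀ {x y} .{{_ : ℚ.NonNegative y}} → 1ℚ ℚ.≤ x → y ℚ.≤ y ℚ.* (x ^ℚ 2)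
1≤x⇒y≤y*x² {x} {y} 1≤x = begin
  y                        ≡⟨ ℚ.*-identityʳ y ⟨
  y ℚ.* 1ℚ                 ≤⟨ ℚ.*-monoˡ-≤-nonNeg y 1≤x ⟩
  y ℚ.* x                  ≡⟨ cong (y ℚ.*_) (ℚ.*-identityʳ x) ⟨
  y ℚ.* (x ℚ.* 1ℚ)         ≤⟨ ℚ.*-monoˡ-≤-nonNeg y (ℚ.*-monoˡ-≤-nonNeg x 1≤x) ⟩
  y ℚ.* (x ℚ.* x)          ≡⟨ cong (λ z → y ℚ.* (x ℚ.* z)) (ℚ.*-identityʳ x) ⟨
  y ℚ.* (x ^ℚ 2)           ∎
  where
  open ℚ.≤-Reasoning
  instance
    _ : ℚ.NonNegative x
    _ = ℚ.nonNegative (ℚ.≤-trans (ℚ.nonNegative⁻¹ 1ℚ) 1≤x)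

theorem13 : ∃[ c ] (0ℚ ℚ.< c × (∀ (n k : ℕ) → 2 ≤ n → 1 ≤ k →
    (∃[ C ] Computes-MAJ {k} {n} C) → LowerBound c n k))
theorem13 = c , ℚ.positive⁻¹ c , λ n k 2≤n 1≤k (C , computes) p q log₂n≤p/q → begin
  (c ^ℚ 19) ℚ.* ℕ→ℚ (n ^ 13)               ≤⟨ ℚ.*-monoˡ-≤-nonNeg (c ^ℚ 19) {{nonNeg-c^ 19}}
                                                (ℕ→ℚ-mono (size-bound C computes 2≤n 1≤k)) ⟩
  (c ^ℚ 19) ℚ.* ℕ→ℚ ((128 * k) ^ 19)       ≡⟨ c^19*128k^19≡k^19 k ⟩
  ℕ→ℚ (k ^ 19)                             ≤⟨ 1≤x⇒y≤y*x² {{ℚ.nonNegative (ℕ→ℚ-mono {0} {k ^ 19} z≤n)}}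
                                                (/-mono-≤ 1 1 p q (1≤p/q {n} {p} {q} 2≤n log₂n≤p/q)) ⟩
  ℕ→ℚ (k ^ 19) ℚ.* ((+ p ℚ./ q) ^ℚ 2)      ∎
  where
  open ℚ.≤-Reasoning
  1≤p/q : ∀ {n p q} → 2 ≤ n → log₂ n ≤ p ÷ q → 1 * q ≤ p * 1
  1≤p/q {n} {p} {q} 2≤n log₂n≤p/q =
    subst₂ _≤_ (sym (*-identityˡ q)) (sym (*-identityʳ p)) (1≤log₂ 2≤n log₂n≤p/q)
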